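{- Let $P(n)$ denote the number of prefix normal binary words of length $n$. Then $P(n)=2^{n-\Theta((\log n)^2)}$ as $n\to\infty$; that is, there exist constants $0<c_1\le c_2$ such that for all sufficiently large $n$, $2^{n-c_2(\log n)^2}\le P(n)\le 2^{n-c_1(\log n)^2}$.
   Context: For a binary word $w=w_1w_2\dots w_n\in\{0,1\}^n$ and $1\le j\le k\le n$, let $w[j,k]=w_jw_{j+1}\dots w_k$, and let $|u|_1$ denote the number of 1s in a binary word $u$ (with $|w[1,0]|_1=0$). The word $w$ is called prefix normal if for every $0\le k\le n$ and every $0\le j\le n-k$ we have $|w[1,k]|_1\ge |w[j+1,j+k]|_1$, i.e. no subword of length $k$ contains more 1s than the prefix of length $k$. -}

module Defs where

open import Data.Bool using (Bool; true; false)
open import Data.List using (List; []; _∷_; length; take; drop; filter; map; _++_)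
open import Data.Nat using (ℕ; zero; suc; _+_; _≤_; _<_; _≤?_; s≤s)
open import Data.Nat.Properties using (allUpTo?; ≤-trans; m≤n+m; m≤m+n; n<1+n)
open import Relation.Nullary using (Dec; yes; no; ¬_)
open import Relation.Nullary.Decidable using (_→-dec_)
open import Relation.Unary using (Decidable)

ones : List Bool → ℕ
ones []           = 0
ones (true ∷ w)   = suc (ones w)
ones (false ∷ w)  = ones w

PrefixNormal : List Bool → Set
PrefixNormal w = ∀ k j → j + k ≤ length w → ones (take k (drop j w)) ≤ ones (take k w)

words : ℕ → List (List Bool)
words zero    = [] ∷ []
words (suc n) = map (false ∷_) (words n) ++ map (true ∷_) (words n)

private
  Body : List Bool → ℕ → ℕ → Set
  Body w k j = j + k ≤ length w → ones (take k (drop j w)) ≤ ones (take k w)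

  body? : ∀ w k j → Dec (Body w k j)
  body? w k j = (j + k ≤? length w) →-dec (ones (take k (drop j w)) ≤? ones (take k w))

  inner? : ∀ w k → Dec (∀ {j} → j < suc (length w) → Body w k j)
  inner? w k = allUpTo? (body? w k) (suc (length w))

  outer? : ∀ w → Dec (∀ {k} → k < suc (length w) → ∀ {j} → j < suc (length w) → Body w k j)
  outer? w = allUpTo? (λ k → inner? w k) (suc (length w))

prefixNormal? : Decidable PrefixNormal
prefixNormal? w with outer? w
... | yes p = yes λ k j h → p (s≤s (≤-trans (m≤n+m k j) h)) (s≤s (≤-trans (m≤m+n j k) h)) h
... | no ¬p = no λ q → ¬p λ {k} _ {j} _ → q k j

P : ℕ → ℕ
P n = length (filter prefixNormal? (words n))

{-# OPTIONS --safe #-}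

-- Upper bound.  If the prefix of length k of a prefix normal word has few ones, so do all
-- n/k aligned windows of length k; since a random window has an excess of order √(k log n)
-- ones with probability n^-ε, that is very rare.  Hence the prefix has such an excess at
-- every scale k = 4^l, and tilting the letter at position t by a factor 1 + c√(log n / t)
-- shows that each of the ~ log n scales costs a factor n^-c'.
--
-- Lower bound.  Let the letter at position t be 1 with probability (1 + √(K / t))/2, where K
-- is of order log n (rounded to powers of 2, and equal to 1 for t < K).  Such a random word is
-- prefix normal with probability at least 1/2 by a union bound, and the sum of the squares of
-- the probabilities of all words is 2^(-n + O(log² n)), so Cauchy–Schwarz bounds the number of
-- prefix normal words from below.
module Submission where

open import Defs
open import Data.Bool using (Bool; true; false)
open import Data.List using (List; []; _∷_; length; take; drop; filter; map)
open import Data.List.Properties using (drop-drop; filter-++; length-++; length-drop; length-take; take-all; take-take)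
open import Data.Nat
open import Data.Nat.DivMod using (m≡m%n+[m/n]*n; m%n<n; m/n*n≤m; /-mono-≤; m*n/n≡m)
open import Data.Nat.Logarithm using (⌊log₂_⌋; ⌊log₂⌋-mono-≤; ⌊log₂[2^n]⌋≡n; ⌊log₂⌊n/2⌋⌋≡⌊log₂n⌋∸1)
open import Data.Nat.Properties
open import Data.Nat.Tactic.RingSolver using (solve-∀)
open import Data.Product using (Σ; _×_; _,_; proj₁; proj₂)
open import Data.Sum using (inj₁; inj₂)
open import Function using (_∘_; case_of_)
open import Relation.Binary.PropositionalEquality
open import Relation.Nullary using (Dec; yes; no; ¬_; contradiction)
open import Relation.Nullary.Decidable using (_×-dec_)
open import Relation.Unary using (Decidable)

-- Every probability estimate is an inequality between natural numbers: "at most 2^-s" reads `2 ^ s`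
-- times a sum over words being at most the total weight. Quotients are cross-multiplied, and
-- instead of logarithms Bernoulli's inequality, used in both directions, compares `(1 + 1/x)^n`
-- with powers of 2. The upper bound needs a moderate deviation from below: among k letters an
-- excess of order √(k log n) must have probability at least a small power of 1/n. The k letters are
-- cut into about log n equal blocks, and each block has an excess of the order of the root of its
-- length with probability at least 1/256, by a test polynomial of degree four. In the lower bound,
-- tail estimates cannot control windows shorter than about log n, since a random word typically has
-- runs of ones of that order; a prefix consisting of ones only makes such windows harmless. Beyond
-- it, the entropy lost at a scale is about the number of its positions times the squared bias. This
-- is of order K at every scale, hence of order log² n in all.

-- Inequalities for powers, and the binary logarithm.

*-interchange : ∀ a b c d → (a * b) * (c * d) ≡ (a * c) * (b * d)
*-interchange = solve-∀

[x*y]^n : ∀ x y n → (x * y) ^ n ≡ x ^ n * y ^ n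
[x*y]^n x y zero    = refl
[x*y]^n x y (suc n) rewrite [x*y]^n x y n = *-interchange x y (x ^ n) (y ^ n)

n<2^n : ∀ n → n < 2 ^ n
n<2^n zero    = s≤s z≤n
n<2^n (suc n) = begin-strict
  suc n           ≤⟨ n<2^n n ⟩
  2 ^ n           <⟨ m<m+n (2 ^ n) (m^n>0 2 n) ⟩
  2 ^ n + 2 ^ n   ≡⟨ cong (2 ^ n +_) (sym (+-identityʳ (2 ^ n))) ⟩
  2 ^ suc n       ∎
  where open ≤-Reasoning

-- Bernoulli's inequality `1 + n/x ≤ (1 + 1/x)^n` with denominators cleared; the induction step only
-- adds the term `x ^ n * n`.
bernoulli : ∀ x n → x ^ n * (x + n) ≤ suc x ^ n * x
bernoulli x zero    = ≤-reflexive (cong (1 *_) (+-identityʳ x))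
bernoulli x (suc n) = begin
  x * x ^ n * (x + suc n)                  ≤⟨ m≤m+n _ (x ^ n * n) ⟩
  x * x ^ n * (x + suc n) + x ^ n * n      ≡⟨ lem x n (x ^ n) ⟩
  suc x * (x ^ n * (x + n))                ≤⟨ *-monoʳ-≤ (suc x) (bernoulli x n) ⟩
  suc x * (suc x ^ n * x)                  ≡⟨ sym (*-assoc (suc x) (suc x ^ n) x) ⟩
  suc x * suc x ^ n * x                    ∎
  where
  open ≤-Reasoning
  lem : ∀ x n p → x * p * (x + suc n) + p * n ≡ suc x * (p * (x + n))
  lem = solve-∀

2x^x≤[1+x]^x : ∀ x .{{_ : NonZero x}} → 2 * x ^ x ≤ suc x ^ x
2x^x≤[1+x]^x x = *-cancelʳ-≤ _ _ x (begin
  2 * x ^ x * x     ≡⟨ lem x (x ^ x) ⟩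
  x ^ x * (x + x)   ≤⟨ bernoulli x x ⟩
  suc x ^ x * x     ∎)
  where
  open ≤-Reasoning
  lem : ∀ x p → 2 * p * x ≡ p * (x + x)
  lem = solve-∀

-- Every `x` factors `1 + 1/x` at least double the product. Together with `slow-growth` this
-- replaces the use of logarithms.
growth : ∀ x .{{_ : NonZero x}} h {e} → h * x ≤ e → 2 ^ h * x ^ e ≤ suc x ^ e
growth x h {e} hx≤e with m≤n⇒∃[o]m+o≡n hx≤e
... | d , refl = begin
  2 ^ h * x ^ (h * x + d)         ≡⟨ cong (2 ^ h *_) (^-distribˡ-+-* x (h * x) d) ⟩
  2 ^ h * (x ^ (h * x) * x ^ d)   ≡⟨ sym (*-assoc (2 ^ h) _ _) ⟩
  2 ^ h * x ^ (h * x) * x ^ d     ≤⟨ *-mono-≤ step (^-monoˡ-≤ d (n≤1+n x)) ⟩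
  suc x ^ (h * x) * suc x ^ d     ≡⟨ sym (^-distribˡ-+-* (suc x) (h * x) d) ⟩
  suc x ^ (h * x + d)             ∎
  where
  open ≤-Reasoning
  step : 2 ^ h * x ^ (h * x) ≤ suc x ^ (h * x)
  step = begin
    2 ^ h * x ^ (h * x)     ≡⟨ cong (λ k → 2 ^ h * x ^ k) (*-comm h x) ⟩
    2 ^ h * x ^ (x * h)     ≡⟨ cong (2 ^ h *_) (sym (^-*-assoc x x h)) ⟩
    2 ^ h * (x ^ x) ^ h     ≡⟨ sym ([x*y]^n 2 (x ^ x) h) ⟩
    (2 * x ^ x) ^ h         ≤⟨ ^-monoˡ-≤ h (2x^x≤[1+x]^x x) ⟩
    (suc x ^ x) ^ h         ≡⟨ ^-*-assoc (suc x) x h ⟩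
    suc x ^ (x * h)         ≡⟨ cong (suc x ^_) (*-comm x h) ⟩
    suc x ^ (h * x)         ∎

-- This is `(1 + 1/x)^n ≤ 1 / (1 - n/x)` with `d = x - n`. A further factor `1 + 1/x` is paid for by
-- lowering `suc d` to `d`, because `d ≤ x`.
reverse-bernoulli : ∀ x n d → n + d ≡ x → suc x ^ n * d ≤ x ^ n * x
reverse-bernoulli x zero    d refl = ≤-refl
reverse-bernoulli x (suc n) d refl = begin
  suc x * suc x ^ n * d       ≡⟨ lem₁ x (suc x ^ n) d ⟩
  suc x ^ n * (suc x * d)     ≤⟨ *-monoʳ-≤ (suc x ^ n) [1+x]d≤x[1+d] ⟩
  suc x ^ n * (x * suc d)     ≡⟨ lem₂ x (suc x ^ n) d ⟩
  x * (suc x ^ n * suc d)     ≤⟨ *-monoʳ-≤ x (reverse-bernoulli x n (suc d) (+-suc n d)) ⟩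
  x * (x ^ n * x)             ≡⟨ sym (*-assoc x (x ^ n) x) ⟩
  x * x ^ n * x               ∎
  where
  open ≤-Reasoning
  lem₁ : ∀ x p d → suc x * p * d ≡ p * (suc x * d)
  lem₁ = solve-∀
  lem₂ : ∀ x p d → p * (x * suc d) ≡ x * (p * suc d)
  lem₂ = solve-∀
  [1+x]d≤x[1+d] : suc x * d ≤ x * suc d
  [1+x]d≤x[1+d] = begin
    d + x * d   ≤⟨ +-monoˡ-≤ (x * d) (m≤n+m d (suc n)) ⟩
    x + x * d   ≡⟨ sym (*-suc x d) ⟩
    x * suc d   ∎

[1+x]^y≤2x^y : ∀ x .{{_ : NonZero x}} y → 2 * y ≤ x → suc x ^ y ≤ 2 * x ^ y
[1+x]^y≤2x^y x y 2y≤x with m≤n⇒∃[o]m+o≡n (≤-trans (m≤m+n y _) 2y≤x)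
... | zero , y+0≡x = contradiction 2y≤x (<⇒≱ (begin-strict
    x           ≡⟨ sym x≡y ⟩
    y           <⟨ m<m+n y {y} (subst (0 <_) (sym x≡y) (>-nonZero⁻¹ x)) ⟩
    y + y       ≡⟨ cong (y +_) (sym (+-identityʳ y)) ⟩
    2 * y       ∎))
  where
  open ≤-Reasoning
  x≡y : y ≡ x
  x≡y = trans (sym (+-identityʳ y)) y+0≡x
... | suc d , y+d≡x = *-cancelʳ-≤ _ _ (suc d) (begin
    suc x ^ y * suc d          ≤⟨ reverse-bernoulli x y (suc d) y+d≡x ⟩
    x ^ y * x                  ≤⟨ *-monoʳ-≤ (x ^ y) x≤2d ⟩
    x ^ y * (suc d + suc d)    ≡⟨ lem (x ^ y) (suc d) ⟩
    2 * x ^ y * suc d          ∎)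
  where
  open ≤-Reasoning
  lem : ∀ p d → p * (d + d) ≡ 2 * p * d
  lem = solve-∀
  y≤d : y ≤ suc d
  y≤d = +-cancelˡ-≤ y y (suc d) (begin
    y + y        ≡⟨ cong (y +_) (sym (+-identityʳ y)) ⟩
    2 * y        ≤⟨ 2y≤x ⟩
    x            ≡⟨ sym y+d≡x ⟩
    y + suc d    ∎)
  x≤2d : x ≤ suc d + suc d
  x≤2d = begin
    x              ≡⟨ sym y+d≡x ⟩
    y + suc d      ≤⟨ +-monoˡ-≤ (suc d) y≤d ⟩
    suc d + suc d  ∎

-- The exponent is padded by `e` to the multiple `h * y` of `y`, where every `y` factors `1 + 1/x`
-- contribute at most 2; then the padding is cancelled.
slow-growth : ∀ x .{{_ : NonZero x}} y h {m} → 2 * y ≤ x → m ≤ h * y → suc x ^ m ≤ 2 ^ h * x ^ m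
slow-growth x y h {m} 2y≤x m≤hy with m≤n⇒∃[o]m+o≡n m≤hy
... | e , m+e≡hy = *-cancelʳ-≤ _ _ (x ^ e) {{m^n≢0 x e}} (begin
  suc x ^ m * x ^ e          ≤⟨ *-monoʳ-≤ (suc x ^ m) (^-monoˡ-≤ e (n≤1+n x)) ⟩
  suc x ^ m * suc x ^ e      ≡⟨ sym (^-distribˡ-+-* (suc x) m e) ⟩
  suc x ^ (m + e)            ≡⟨ cong (suc x ^_) (trans m+e≡hy (*-comm h y)) ⟩
  suc x ^ (y * h)            ≡⟨ sym (^-*-assoc (suc x) y h) ⟩
  (suc x ^ y) ^ h            ≤⟨ ^-monoˡ-≤ h ([1+x]^y≤2x^y x y 2y≤x) ⟩
  (2 * x ^ y) ^ h            ≡⟨ [x*y]^n 2 (x ^ y) h ⟩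
  2 ^ h * (x ^ y) ^ h        ≡⟨ cong (2 ^ h *_) (^-*-assoc x y h) ⟩
  2 ^ h * x ^ (y * h)        ≡⟨ cong (λ k → 2 ^ h * x ^ k) (trans (*-comm y h) (sym m+e≡hy)) ⟩
  2 ^ h * x ^ (m + e)        ≡⟨ cong (2 ^ h *_) (^-distribˡ-+-* x m e) ⟩
  2 ^ h * (x ^ m * x ^ e)    ≡⟨ sym (*-assoc (2 ^ h) _ _) ⟩
  2 ^ h * x ^ m * x ^ e      ∎)
  where open ≤-Reasoning

2^⌊log₂n⌋≤n : ∀ n .{{_ : NonZero n}} → 2 ^ ⌊log₂ n ⌋ ≤ n
2^⌊log₂n⌋≤n n = go ⌊log₂ n ⌋ n refl
  where
  go : ∀ L n .{{_ : NonZero n}} → ⌊log₂ n ⌋ ≡ L → 2 ^ L ≤ n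
  go zero    n             log≡ = >-nonZero⁻¹ n
  go (suc L) n@(suc (suc k)) log≡ = begin
    2 * 2 ^ L            ≤⟨ *-monoʳ-≤ 2 (go L ⌊ n /2⌋ (trans (⌊log₂⌊n/2⌋⌋≡⌊log₂n⌋∸1 n) (cong (_∸ 1) log≡))) ⟩
    2 * ⌊ n /2⌋          ≡⟨ cong (⌊ n /2⌋ +_) (+-identityʳ ⌊ n /2⌋) ⟩
    ⌊ n /2⌋ + ⌊ n /2⌋    ≤⟨ +-monoʳ-≤ ⌊ n /2⌋ (⌊n/2⌋≤⌈n/2⌉ n) ⟩
    ⌊ n /2⌋ + ⌈ n /2⌉    ≡⟨ ⌊n/2⌋+⌈n/2⌉≡n n ⟩
    n                    ∎
    where open ≤-Reasoning

n<2^[1+⌊log₂n⌋] : ∀ n → n < 2 ^ suc ⌊log₂ n ⌋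
n<2^[1+⌊log₂n⌋] n = ≰⇒> λ 2^≤n →
  <⇒≱ (n<1+n ⌊log₂ n ⌋) (subst (_≤ ⌊log₂ n ⌋) (⌊log₂[2^n]⌋≡n (suc ⌊log₂ n ⌋)) (⌊log₂⌋-mono-≤ 2^≤n))

-- Sums over words

⟦_⟧ : ∀ {A : Set} → Dec A → ℕ
⟦ yes _ ⟧ = 1
⟦ no  _ ⟧ = 0

sumW : ℕ → (List Bool → ℕ) → ℕ
sumW zero    f = f []
sumW (suc n) f = sumW n (f ∘ (false ∷_)) + sumW n (f ∘ (true ∷_))

sumW-mono : ∀ n {f g} → (∀ w → length w ≡ n → f w ≤ g w) → sumW n f ≤ sumW n g
sumW-mono zero    f≤g = f≤g [] refl
sumW-mono (suc n) f≤g = +-mono-≤ (sumW-mono n λ w e → f≤g _ (cong suc e))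
                                 (sumW-mono n λ w e → f≤g _ (cong suc e))

sumW-cong : ∀ n {f g} → (∀ w → length w ≡ n → f w ≡ g w) → sumW n f ≡ sumW n g
sumW-cong n f≡g = ≤-antisym (sumW-mono n λ w e → ≤-reflexive (f≡g w e))
                            (sumW-mono n λ w e → ≤-reflexive (sym (f≡g w e)))

+-interchange : ∀ a b c d → (a + b) + (c + d) ≡ (a + c) + (b + d)
+-interchange = solve-∀

sumW-+ : ∀ n f g → sumW n (λ w → f w + g w) ≡ sumW n f + sumW n g
sumW-+ zero    f g = refl
sumW-+ (suc n) f g rewrite sumW-+ n (f ∘ (false ∷_)) (g ∘ (false ∷_))
                         | sumW-+ n (f ∘ (true ∷_)) (g ∘ (true ∷_)) =
  +-interchange (sumW n (f ∘ (false ∷_))) _ _ _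

sumW-*ˡ : ∀ n c f → sumW n (λ w → c * f w) ≡ c * sumW n f
sumW-*ˡ zero    c f = refl
sumW-*ˡ (suc n) c f rewrite sumW-*ˡ n c (f ∘ (false ∷_)) | sumW-*ˡ n c (f ∘ (true ∷_)) =
  sym (*-distribˡ-+ c _ _)

sumW-1 : ∀ n → sumW n (λ _ → 1) ≡ 2 ^ n
sumW-1 zero    = refl
sumW-1 (suc n) rewrite sumW-1 n = cong (2 ^ n +_) (sym (+-identityʳ (2 ^ n)))

sumW-0 : ∀ n → sumW n (λ _ → 0) ≡ 0
sumW-0 zero    = refl
sumW-0 (suc n) rewrite sumW-0 n = refl

-- Independence of the letters before and after position `m`; all computations with disjoint windows
-- rest on it.
sumW-take-drop : ∀ m n f g → sumW (m + n) (λ w → f (take m w) * g (drop m w)) ≡ sumW m f * sumW n g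
sumW-take-drop zero    n f g = sumW-*ˡ n (f []) g
sumW-take-drop (suc m) n f g
  rewrite sumW-take-drop m n (f ∘ (false ∷_)) g | sumW-take-drop m n (f ∘ (true ∷_)) g =
  sym (*-distribʳ-+ (sumW n g) (sumW m (f ∘ (false ∷_))) _)

cnt : ℕ → ℕ → ℕ
cnt n a = sumW n (λ w → ⟦ a ≤? ones w ⟧)

length-filter-map : ∀ {A B : Set} {Q : B → Set} (Q? : Decidable Q) (f : A → B) xs →
                    length (filter Q? (map f xs)) ≡ length (filter (λ x → Q? (f x)) xs)
length-filter-map Q? f []       = refl
length-filter-map Q? f (x ∷ xs) with Q? (f x)
... | yes _ = cong suc (length-filter-map Q? f xs)
... | no  _ = length-filter-map Q? f xs

length-filter-words : ∀ n {Q : List Bool → Set} (Q? : Decidable Q) →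
                      length (filter Q? (words n)) ≡ sumW n (λ w → ⟦ Q? w ⟧)
length-filter-words zero Q? with Q? []
... | yes _ = refl
... | no  _ = refl
length-filter-words (suc n) Q?
  rewrite filter-++ Q? (map (false ∷_) (words n)) (map (true ∷_) (words n))
        | length-++ (filter Q? (map (false ∷_) (words n))) {filter Q? (map (true ∷_) (words n))}
        | length-filter-map Q? (false ∷_) (words n)
        | length-filter-map Q? (true ∷_) (words n)
        | length-filter-words n (λ w → Q? (false ∷ w))
        | length-filter-words n (λ w → Q? (true ∷ w)) = refl

P≡sumW : ∀ n → P n ≡ sumW n (λ w → ⟦ prefixNormal? w ⟧)
P≡sumW n = length-filter-words n prefixNormal?

-- Product weights on words.

-- An unnormalised product measure: the weights stay natural numbers, and the product of the totals
-- in `sumW-wt` is the normalising constant.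
wt : (ℕ → Bool → ℕ) → List Bool → ℕ
wt φ []      = 1
wt φ (b ∷ w) = φ 0 b * wt (φ ∘ suc) w

prod : ℕ → (ℕ → ℕ) → ℕ
prod zero    f = 1
prod (suc n) f = f 0 * prod n (f ∘ suc)

total : (ℕ → Bool → ℕ) → ℕ → ℕ
total φ t = φ t false + φ t true

sumW-wt : ∀ n φ → sumW n (wt φ) ≡ prod n (total φ)
sumW-wt zero    φ = refl
sumW-wt (suc n) φ = begin
  sumW n (λ w → φ 0 false * wt (φ ∘ suc) w) + sumW n (λ w → φ 0 true * wt (φ ∘ suc) w)
    ≡⟨ cong₂ _+_ (sumW-*ˡ n (φ 0 false) _) (sumW-*ˡ n (φ 0 true) _) ⟩
  φ 0 false * sumW n (wt (φ ∘ suc)) + φ 0 true * sumW n (wt (φ ∘ suc))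
    ≡⟨ sym (*-distribʳ-+ (sumW n (wt (φ ∘ suc))) (φ 0 false) (φ 0 true)) ⟩
  total φ 0 * sumW n (wt (φ ∘ suc))
    ≡⟨ cong (total φ 0 *_) (sumW-wt n (φ ∘ suc)) ⟩
  total φ 0 * prod n (total (φ ∘ suc)) ∎
  where open ≡-Reasoning

wt-split : ∀ k φ w → wt φ w ≡ wt φ (take k w) * wt (φ ∘ (k +_)) (drop k w)
wt-split zero    φ w       = sym (*-identityˡ (wt φ w))
wt-split (suc k) φ []      = refl
wt-split (suc k) φ (b ∷ w) rewrite wt-split k (φ ∘ suc) w =
  sym (*-assoc (φ 0 b) (wt (φ ∘ suc) (take k w)) _)

wt-* : ∀ φ ψ w → wt (λ t b → φ t b * ψ t b) w ≡ wt φ w * wt ψ w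
wt-* φ ψ []      = refl
wt-* φ ψ (b ∷ w) rewrite wt-* (φ ∘ suc) (ψ ∘ suc) w = *-interchange (φ 0 b) (ψ 0 b) _ _

ones≤length : ∀ w → ones w ≤ length w
ones≤length []          = z≤n
ones≤length (true  ∷ w) = s≤s (ones≤length w)
ones≤length (false ∷ w) = m≤n⇒m≤1+n (ones≤length w)

tilt : ℕ → ℕ → Bool → ℕ
tilt x y true  = x
tilt x y false = y

wt-tilt : ∀ x y w z → ones w + z ≡ length w → wt (λ _ → tilt x y) w ≡ x ^ ones w * y ^ z
wt-tilt x y []          zero    refl = refl
wt-tilt x y (true  ∷ w) z       eq   rewrite wt-tilt x y w z (suc-injective eq) = sym (*-assoc x _ _)
wt-tilt x y (false ∷ w) zero    eq   =
  contradiction (trans (sym (+-identityʳ (ones w))) eq) (<⇒≢ (s≤s (ones≤length w)))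
wt-tilt x y (false ∷ w) (suc z) eq
  rewrite wt-tilt x y w z (suc-injective (trans (sym (+-suc (ones w) z)) eq)) =
  lem y (x ^ ones w) (y ^ z)
  where
  lem : ∀ y p r → y * (p * r) ≡ p * (y * r)
  lem = solve-∀

prod-mono : ∀ n {f g} → (∀ t → t < n → f t ≤ g t) → prod n f ≤ prod n g
prod-mono zero    f≤g = ≤-refl
prod-mono (suc n) f≤g = *-mono-≤ (f≤g 0 (s≤s z≤n)) (prod-mono n λ t t<n → f≤g (suc t) (s≤s t<n))

prod-cong : ∀ n {f g} → (∀ t → t < n → f t ≡ g t) → prod n f ≡ prod n g
prod-cong zero    f≡g = refl
prod-cong (suc n) f≡g = cong₂ _*_ (f≡g 0 (s≤s z≤n)) (prod-cong n λ t t<n → f≡g (suc t) (s≤s t<n))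

prod-* : ∀ n f g → prod n (λ t → f t * g t) ≡ prod n f * prod n g
prod-* zero    f g = refl
prod-* (suc n) f g rewrite prod-* n (f ∘ suc) (g ∘ suc) = *-interchange (f 0) (g 0) _ _

prod-const : ∀ n c → prod n (λ _ → c) ≡ c ^ n
prod-const zero    c = refl
prod-const (suc n) c = cong (c *_) (prod-const n c)

prod-+ : ∀ m n f → prod (m + n) f ≡ prod m f * prod n (f ∘ (m +_))
prod-+ zero    n f = sym (*-identityˡ (prod n f))
prod-+ (suc m) n f rewrite prod-+ m n (f ∘ suc) = sym (*-assoc (f 0) _ _)

prod≢0 : ∀ n {f} → (∀ t → 0 < f t) → NonZero (prod n f)
prod≢0 zero    f>0 = _
prod≢0 (suc n) {f} f>0 = m*n≢0 (f 0) (prod n (f ∘ suc)) {{>-nonZero (f>0 0)}} {{prod≢0 n (f>0 ∘ suc)}}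

sumN : ℕ → (ℕ → ℕ) → ℕ
sumN zero    f = 0
sumN (suc n) f = f n + sumN n f

sumN-≤ : ∀ n {f} c → (∀ i → i < n → f i ≤ c) → sumN n f ≤ n * c
sumN-≤ zero    c f≤c = z≤n
sumN-≤ (suc n) c f≤c = +-mono-≤ (f≤c n ≤-refl) (sumN-≤ n c λ i i<n → f≤c i (m≤n⇒m≤1+n i<n))

term≤sumN : ∀ n f {i} → i < n → f i ≤ sumN n f
term≤sumN (suc n) f {i} (s≤s i≤n) with m≤n⇒m<n∨m≡n i≤n
... | inj₁ i<n  = ≤-trans (term≤sumN n f i<n) (m≤n+m _ (f n))
... | inj₂ refl = m≤m+n (f n) _

sumN-*ˡ : ∀ n c f → sumN n (λ i → c * f i) ≡ c * sumN n f
sumN-*ˡ zero    c f = sym (*-zeroʳ c)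
sumN-*ˡ (suc n) c f rewrite sumN-*ˡ n c f = sym (*-distribˡ-+ c (f n) _)

sumN-*ʳ : ∀ n f c → sumN n f * c ≡ sumN n (λ i → f i * c)
sumN-*ʳ zero    f c = refl
sumN-*ʳ (suc n) f c = trans (*-distribʳ-+ c (f n) _) (cong (f n * c +_) (sumN-*ʳ n f c))

sumN-cong : ∀ n {f g : ℕ → ℕ} → (∀ i → f i ≡ g i) → sumN n f ≡ sumN n g
sumN-cong zero    f≡g = refl
sumN-cong (suc n) f≡g = cong₂ _+_ (f≡g n) (sumN-cong n f≡g)

sumW-sumN : ∀ n m (f : ℕ → List Bool → ℕ) →
            sumW n (λ w → sumN m (λ i → f i w)) ≡ sumN m (λ i → sumW n (f i))
sumW-sumN n zero    f = sumW-0 n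
sumW-sumN n (suc m) f rewrite sumW-+ n (f m) (λ w → sumN m (λ i → f i w)) | sumW-sumN n m f = refl

ones-++take : ∀ j k w → ones (take (j + k) w) ≡ ones (take j w) + ones (take k (drop j w))
ones-++take zero    k w           = refl
ones-++take (suc j) zero []       = refl
ones-++take (suc j) (suc k) []    = refl
ones-++take (suc j) k (true  ∷ w) = cong suc (ones-++take j k w)
ones-++take (suc j) k (false ∷ w) = ones-++take j k w

length-take-≤ : ∀ k (w : List Bool) → k ≤ length w → length (take k w) ≡ k
length-take-≤ zero    w       _         = refl
length-take-≤ (suc k) (b ∷ w) (s≤s k≤w) = cong suc (length-take-≤ k w k≤w)

zeros : ∀ w → Σ ℕ λ z → ones w + z ≡ length w
zeros []          = 0 , refl
zeros (true  ∷ w) = let z , eq = zeros w in z , cong suc eq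
zeros (false ∷ w) = let z , eq = zeros w in suc z , trans (+-suc (ones w) z) (cong suc eq)

-- The Cauchy-Schwarz inequality for sums over words.

square-cancel-≤ : ∀ {x y} → x * x ≤ y * y → x ≤ y
square-cancel-≤ {x} {y} xx≤yy with x ≤? y
... | yes x≤y = x≤y
... | no  x≰y = contradiction xx≤yy (<⇒≱ (*-mono-< (≰⇒> x≰y) (≰⇒> x≰y)))

4xy≤[x+y]² : ∀ x y → 4 * (x * y) ≤ (x + y) * (x + y)
4xy≤[x+y]² x y with ≤-total x y
... | inj₁ x≤y with m≤n⇒∃[o]m+o≡n x≤y
...   | d , refl = ≤-trans (m≤m+n _ (d * d)) (≤-reflexive (lem x d))
  where
  lem : ∀ x d → 4 * (x * (x + d)) + d * d ≡ (x + (x + d)) * (x + (x + d))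
  lem = solve-∀
4xy≤[x+y]² x y | inj₂ y≤x with m≤n⇒∃[o]m+o≡n y≤x
...   | d , refl = ≤-trans (m≤m+n _ (d * d)) (≤-reflexive (lem y d))
  where
  lem : ∀ y d → 4 * ((y + d) * y) + d * d ≡ (y + d + y) * (y + d + y)
  lem = solve-∀

-- The cross terms are compared through their squares, `(2ab)² ≤ 4 (AD)(BC) ≤ (AD + BC)²`, which
-- avoids square roots.
cauchy-schwarz₂ : ∀ {a b A B C D} → a * a ≤ A * C → b * b ≤ B * D → (a + b) * (a + b) ≤ (A + B) * (C + D)
cauchy-schwarz₂ {a} {b} {A} {B} {C} {D} aa≤ bb≤ = begin
  (a + b) * (a + b)                        ≡⟨ lem₁ a b ⟩
  a * a + b * b + 2 * (a * b)              ≤⟨ +-mono-≤ (+-mono-≤ aa≤ bb≤) cross ⟩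
  A * C + B * D + (A * D + B * C)          ≡⟨ lem₂ A B C D ⟩
  (A + B) * (C + D)                        ∎
  where
  open ≤-Reasoning
  lem₁ : ∀ a b → (a + b) * (a + b) ≡ a * a + b * b + 2 * (a * b)
  lem₁ = solve-∀
  lem₂ : ∀ A B C D → A * C + B * D + (A * D + B * C) ≡ (A + B) * (C + D)
  lem₂ = solve-∀
  cross : 2 * (a * b) ≤ A * D + B * C
  cross = square-cancel-≤ (begin
    2 * (a * b) * (2 * (a * b))              ≡⟨ lem a b ⟩
    4 * ((a * a) * (b * b))                  ≤⟨ *-monoʳ-≤ 4 (*-mono-≤ aa≤ bb≤) ⟩
    4 * ((A * C) * (B * D))                  ≡⟨ cong (4 *_) (lem′ A B C D) ⟩
    4 * ((A * D) * (B * C))                  ≤⟨ 4xy≤[x+y]² (A * D) (B * C) ⟩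
    (A * D + B * C) * (A * D + B * C)        ∎)
    where
    lem : ∀ a b → 2 * (a * b) * (2 * (a * b)) ≡ 4 * ((a * a) * (b * b))
    lem = solve-∀
    lem′ : ∀ A B C D → (A * C) * (B * D) ≡ (A * D) * (B * C)
    lem′ = solve-∀

cauchy-schwarz : ∀ n (f g : List Bool → ℕ) →
                 sumW n (λ w → f w * g w) * sumW n (λ w → f w * g w) ≤
                 sumW n (λ w → f w * f w) * sumW n (λ w → g w * g w)
cauchy-schwarz zero    f g = ≤-reflexive (*-interchange (f []) (g []) (f []) (g []))
cauchy-schwarz (suc n) f g =
  cauchy-schwarz₂ {a = sumW n (λ w → f₀ w * g₀ w)} {sumW n (λ w → f₁ w * g₁ w)}
                  {sumW n (λ w → f₀ w * f₀ w)} {sumW n (λ w → f₁ w * f₁ w)}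
    (cauchy-schwarz n f₀ g₀) (cauchy-schwarz n f₁ g₁)
  where
  f₀ f₁ g₀ g₁ : List Bool → ℕ
  f₀ = f ∘ (false ∷_)
  f₁ = f ∘ (true ∷_)
  g₀ = g ∘ (false ∷_)
  g₁ = g ∘ (true ∷_)

-- Anti-concentration of the number of ones.

module AntiConcentration where

  open import Data.Integer using (ℤ; +_; -[1+_]; +≤+)
    renaming (_+_ to _+ᶻ_; _*_ to _*ᶻ_; _-_ to _-ᶻ_; -_ to -ᶻ_; _≤_ to _≤ᶻ_)
  import Data.Integer.Properties as ℤ
  import Data.Integer.Tactic.RingSolver as ℤ

  sumZ : ℕ → (List Bool → ℤ) → ℤ
  sumZ zero    f = f []
  sumZ (suc n) f = sumZ n (f ∘ (false ∷_)) +ᶻ sumZ n (f ∘ (true ∷_))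

  sumZ-mono : ∀ n {f g} → (∀ w → length w ≡ n → f w ≤ᶻ g w) → sumZ n f ≤ᶻ sumZ n g
  sumZ-mono zero    f≤g = f≤g [] refl
  sumZ-mono (suc n) f≤g = ℤ.+-mono-≤ (sumZ-mono n λ w e → f≤g _ (cong suc e))
                                     (sumZ-mono n λ w e → f≤g _ (cong suc e))

  sumZ-pos : ∀ n f → sumZ n (λ w → + f w) ≡ + sumW n f
  sumZ-pos zero    f = refl
  sumZ-pos (suc n) f rewrite sumZ-pos n (f ∘ (false ∷_)) | sumZ-pos n (f ∘ (true ∷_)) = refl

  walk : ℤ → List Bool → ℤ
  walk x []          = x
  walk x (false ∷ w) = walk (x -ᶻ + 1) w
  walk x (true  ∷ w) = walk (x +ᶻ + 1) w

  walk-ones : ∀ x w → walk x w ≡ x +ᶻ + 2 *ᶻ + ones w -ᶻ + length w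
  walk-ones x []          = lem x
    where
    lem : ∀ x → x ≡ x +ᶻ + 2 *ᶻ + 0 -ᶻ + 0
    lem = ℤ.solve-∀
  walk-ones x (false ∷ w) = trans (walk-ones (x -ᶻ + 1) w) (lem x (+ ones w) (+ length w))
    where
    lem : ∀ x o l → (x -ᶻ + 1) +ᶻ + 2 *ᶻ o -ᶻ l ≡ x +ᶻ + 2 *ᶻ o -ᶻ (+ 1 +ᶻ l)
    lem = ℤ.solve-∀
  walk-ones x (true ∷ w)  = trans (walk-ones (x +ᶻ + 1) w) (lem x (+ ones w) (+ length w))
    where
    lem : ∀ x o l → (x +ᶻ + 1) +ᶻ + 2 *ᶻ o -ᶻ l ≡ x +ᶻ + 2 *ᶻ (+ 1 +ᶻ o) -ᶻ (+ 1 +ᶻ l)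
    lem = ℤ.solve-∀

  module _ (c₃ c₂ c₁ c₀ : ℤ) where

    quartic : ℤ → ℤ
    quartic y = c₀ +ᶻ c₁ *ᶻ y +ᶻ c₂ *ᶻ (y *ᶻ y) +ᶻ c₃ *ᶻ (y *ᶻ y *ᶻ y) -ᶻ y *ᶻ y *ᶻ y *ᶻ y

    -- The moments, up to the fourth, of a simple random walk after `n` steps from `x`. As `n` is an
    -- integer variable, the recursion in `sumZ-quartic` is a ring identity.
    quartic-mean : ℤ → ℤ → ℤ
    quartic-mean n x =
      c₀ +ᶻ c₁ *ᶻ x +ᶻ c₂ *ᶻ (x *ᶻ x +ᶻ n) +ᶻ c₃ *ᶻ (x *ᶻ x *ᶻ x +ᶻ + 3 *ᶻ n *ᶻ x)
      -ᶻ (x *ᶻ x *ᶻ x *ᶻ x +ᶻ + 6 *ᶻ n *ᶻ (x *ᶻ x) +ᶻ + 3 *ᶻ n *ᶻ n -ᶻ + 2 *ᶻ n)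

    sumZ-quartic : ∀ n x → sumZ n (λ w → quartic (walk x w)) ≡ + (2 ^ n) *ᶻ quartic-mean (+ n) x
    sumZ-quartic zero    x = base c₃ c₂ c₁ c₀ x
      where
      base : ∀ c₃ c₂ c₁ c₀ x →
        c₀ +ᶻ c₁ *ᶻ x +ᶻ c₂ *ᶻ (x *ᶻ x) +ᶻ c₃ *ᶻ (x *ᶻ x *ᶻ x) -ᶻ x *ᶻ x *ᶻ x *ᶻ x ≡
        + 1 *ᶻ (c₀ +ᶻ c₁ *ᶻ x +ᶻ c₂ *ᶻ (x *ᶻ x +ᶻ + 0) +ᶻ c₃ *ᶻ (x *ᶻ x *ᶻ x +ᶻ + 3 *ᶻ + 0 *ᶻ x)
        -ᶻ (x *ᶻ x *ᶻ x *ᶻ x +ᶻ + 6 *ᶻ + 0 *ᶻ (x *ᶻ x) +ᶻ + 3 *ᶻ + 0 *ᶻ + 0 -ᶻ + 2 *ᶻ + 0))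
      base = ℤ.solve-∀
    sumZ-quartic (suc n) x = begin
      sumZ n (λ w → quartic (walk (x -ᶻ + 1) w)) +ᶻ sumZ n (λ w → quartic (walk (x +ᶻ + 1) w))
        ≡⟨ cong₂ _+ᶻ_ (sumZ-quartic n (x -ᶻ + 1)) (sumZ-quartic n (x +ᶻ + 1)) ⟩
      + (2 ^ n) *ᶻ quartic-mean (+ n) (x -ᶻ + 1) +ᶻ + (2 ^ n) *ᶻ quartic-mean (+ n) (x +ᶻ + 1)
        ≡⟨ step c₃ c₂ c₁ c₀ x (+ n) (+ (2 ^ n)) ⟩
      (+ 2 *ᶻ + (2 ^ n)) *ᶻ quartic-mean (+ 1 +ᶻ + n) x
        ≡⟨ cong (_*ᶻ quartic-mean (+ suc n) x) (sym (ℤ.pos-* 2 (2 ^ n))) ⟩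
      + (2 ^ suc n) *ᶻ quartic-mean (+ suc n) x ∎
      where
      open ≡-Reasoning
      step : ∀ c₃ c₂ c₁ c₀ x n p →
        p *ᶻ (c₀ +ᶻ c₁ *ᶻ (x -ᶻ + 1) +ᶻ c₂ *ᶻ ((x -ᶻ + 1) *ᶻ (x -ᶻ + 1) +ᶻ n)
             +ᶻ c₃ *ᶻ ((x -ᶻ + 1) *ᶻ (x -ᶻ + 1) *ᶻ (x -ᶻ + 1) +ᶻ + 3 *ᶻ n *ᶻ (x -ᶻ + 1))
             -ᶻ ((x -ᶻ + 1) *ᶻ (x -ᶻ + 1) *ᶻ (x -ᶻ + 1) *ᶻ (x -ᶻ + 1)
                +ᶻ + 6 *ᶻ n *ᶻ ((x -ᶻ + 1) *ᶻ (x -ᶻ + 1)) +ᶻ + 3 *ᶻ n *ᶻ n -ᶻ + 2 *ᶻ n))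
        +ᶻ p *ᶻ (c₀ +ᶻ c₁ *ᶻ (x +ᶻ + 1) +ᶻ c₂ *ᶻ ((x +ᶻ + 1) *ᶻ (x +ᶻ + 1) +ᶻ n)
             +ᶻ c₃ *ᶻ ((x +ᶻ + 1) *ᶻ (x +ᶻ + 1) *ᶻ (x +ᶻ + 1) +ᶻ + 3 *ᶻ n *ᶻ (x +ᶻ + 1))
             -ᶻ ((x +ᶻ + 1) *ᶻ (x +ᶻ + 1) *ᶻ (x +ᶻ + 1) *ᶻ (x +ᶻ + 1)
                +ᶻ + 6 *ᶻ n *ᶻ ((x +ᶻ + 1) *ᶻ (x +ᶻ + 1)) +ᶻ + 3 *ᶻ n *ᶻ n -ᶻ + 2 *ᶻ n))
        ≡ (+ 2 *ᶻ p) *ᶻ (c₀ +ᶻ c₁ *ᶻ x +ᶻ c₂ *ᶻ (x *ᶻ x +ᶻ (+ 1 +ᶻ n))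
             +ᶻ c₃ *ᶻ (x *ᶻ x *ᶻ x +ᶻ + 3 *ᶻ (+ 1 +ᶻ n) *ᶻ x)
             -ᶻ (x *ᶻ x *ᶻ x *ᶻ x +ᶻ + 6 *ᶻ (+ 1 +ᶻ n) *ᶻ (x *ᶻ x) +ᶻ + 3 *ᶻ (+ 1 +ᶻ n) *ᶻ (+ 1 +ᶻ n) -ᶻ + 2 *ᶻ (+ 1 +ᶻ n)))
      step = ℤ.solve-∀

  square-abs : ∀ z → Σ ℕ λ s → z *ᶻ z ≡ + s
  square-abs (+ n)      = n * n , sym (ℤ.pos-* n n)
  square-abs (-[1+ n ]) = suc n * suc n , refl

  neg-product≤0 : ∀ a b z → -ᶻ (+ a *ᶻ + b *ᶻ (z *ᶻ z)) ≤ᶻ + 0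
  neg-product≤0 a b z with square-abs z
  ... | s , z²≡s rewrite z²≡s | sym (ℤ.pos-* a b) | sym (ℤ.pos-* (a * b) s) = ℤ.neg-≤-pos

  module _ (t : ℕ) where

    private
      -- The walk ends at twice the number of ones minus `n`, so with `s = 2t` it ends at `s` or
      -- above exactly if there are at least `a = n/2 + t` ones. Since `n = 16 s²`, `cap = (16 s)⁴`
      -- equals `256 n²`.
      s r cap n a : ℕ
      s   = t + t
      r   = 4 * s
      cap = 4 * r * (4 * r) * (4 * r * (4 * r))
      n   = r * r
      a   = 8 * (s * s) + t

      T S : ℤ
      T = + t
      S = + s

    -- (y - s)(12 s - y)(y + 4 s)²: positive only for s < y < 12 s, bounded above by (16 s)⁴, and
    -- with mean at least (4 s)⁴ over walks of (4 s)² steps, so y ≥ s has probability ≥ 1/256.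
    test : ℤ → ℤ
    test = quartic (+ 5 *ᶻ S) (+ 76 *ᶻ (S *ᶻ S)) (+ 112 *ᶻ (S *ᶻ S *ᶻ S)) (-ᶻ (+ 192 *ᶻ (S *ᶻ S *ᶻ S *ᶻ S)))

    private
      factored : ℤ → ℤ
      factored e = e *ᶻ (+ 11 *ᶻ S -ᶻ e) *ᶻ ((e +ᶻ + 5 *ᶻ S) *ᶻ (e +ᶻ + 5 *ᶻ S))

      test-factor : ∀ e → test (S +ᶻ e) ≡ factored e
      test-factor e = lem S e
        where
        lem : ∀ S e →
          -ᶻ (+ 192 *ᶻ (S *ᶻ S *ᶻ S *ᶻ S)) +ᶻ + 112 *ᶻ (S *ᶻ S *ᶻ S) *ᶻ (S +ᶻ e)
            +ᶻ + 76 *ᶻ (S *ᶻ S) *ᶻ ((S +ᶻ e) *ᶻ (S +ᶻ e))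
            +ᶻ + 5 *ᶻ S *ᶻ ((S +ᶻ e) *ᶻ (S +ᶻ e) *ᶻ (S +ᶻ e))
            -ᶻ (S +ᶻ e) *ᶻ (S +ᶻ e) *ᶻ (S +ᶻ e) *ᶻ (S +ᶻ e) ≡
          e *ᶻ (+ 11 *ᶻ S -ᶻ e) *ᶻ ((e +ᶻ + 5 *ᶻ S) *ᶻ (e +ᶻ + 5 *ᶻ S))
        lem = ℤ.solve-∀

      neg-left : ∀ x y z → (-ᶻ x) *ᶻ y *ᶻ z ≡ -ᶻ (x *ᶻ y *ᶻ z)
      neg-left = ℤ.solve-∀

      neg-middle : ∀ x y z → x *ᶻ (-ᶻ y) *ᶻ z ≡ -ᶻ (x *ᶻ y *ᶻ z)
      neg-middle = ℤ.solve-∀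

      add-sub : ∀ x y → x +ᶻ y -ᶻ x ≡ y
      add-sub = ℤ.solve-∀

      sub-add : ∀ x y → x -ᶻ (x +ᶻ y) ≡ -ᶻ y
      sub-add = ℤ.solve-∀

      -- Up to `11 * s` each of the four linear factors is at most `16 s`; beyond it the second
      -- factor makes the value nonpositive.
      factored-pos : ∀ p → factored (+ p) ≤ᶻ + cap
      factored-pos p with ≤-total p (11 * s)
      ... | inj₁ p≤11s = ℤ.≤-trans (ℤ.≤-reflexive value) (+≤+ bound)
        where
        open ≡-Reasoning
        e x : ℕ
        e = proj₁ (m≤n⇒∃[o]m+o≡n p≤11s)
        x = p + 5 * s
        p+e : p + e ≡ 11 * s
        p+e = proj₂ (m≤n⇒∃[o]m+o≡n p≤11s)
        second : + 11 *ᶻ S -ᶻ + p ≡ + e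
        second = trans (cong (_-ᶻ + p) (trans (sym (ℤ.pos-* 11 s)) (cong +_ (sym p+e)))) (add-sub (+ p) (+ e))
        value : factored (+ p) ≡ + (p * e * (x * x))
        value = begin
          + p *ᶻ (+ 11 *ᶻ S -ᶻ + p) *ᶻ ((+ p +ᶻ + 5 *ᶻ S) *ᶻ (+ p +ᶻ + 5 *ᶻ S))
            ≡⟨ cong₂ (λ y z → + p *ᶻ y *ᶻ ((+ p +ᶻ z) *ᶻ (+ p +ᶻ z))) second (sym (ℤ.pos-* 5 s)) ⟩
          + p *ᶻ + e *ᶻ (+ x *ᶻ + x)
            ≡⟨ cong₂ _*ᶻ_ (sym (ℤ.pos-* p e)) (sym (ℤ.pos-* x x)) ⟩
          + (p * e) *ᶻ + (x * x)
            ≡⟨ sym (ℤ.pos-* (p * e) (x * x)) ⟩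
          + (p * e * (x * x)) ∎
        16s : 16 * s ≡ 4 * r
        16s = *-assoc 4 4 s
        ≤16s : ∀ {y} → y ≤ 11 * s → y ≤ 4 * r
        ≤16s y≤ = ≤-trans y≤ (≤-trans (*-monoˡ-≤ s (≤ᵇ⇒≤ 11 16 _)) (≤-reflexive 16s))
        x≤16s : x ≤ 4 * r
        x≤16s = ≤-trans (+-monoˡ-≤ (5 * s) p≤11s) (≤-reflexive (trans (sym (*-distribʳ-+ s 11 5)) 16s))
        bound : p * e * (x * x) ≤ cap
        bound = *-mono-≤ (*-mono-≤ (≤16s p≤11s) (≤16s (subst (e ≤_) p+e (m≤n+m e p)))) (*-mono-≤ x≤16s x≤16s)
      ... | inj₂ 11s≤p = ℤ.≤-trans (ℤ.≤-reflexive (trans (cong (λ y → + p *ᶻ y *ᶻ (z *ᶻ z)) second)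
                                                         (neg-middle (+ p) (+ e) (z *ᶻ z))))
                           (ℤ.≤-trans (neg-product≤0 p e z) (+≤+ z≤n))
        where
        e : ℕ
        e = proj₁ (m≤n⇒∃[o]m+o≡n 11s≤p)
        z : ℤ
        z = + p +ᶻ + 5 *ᶻ S
        second : + 11 *ᶻ S -ᶻ + p ≡ -ᶻ + e
        second = trans (cong (λ y → + 11 *ᶻ S -ᶻ y) (trans (cong +_ (sym (proj₂ (m≤n⇒∃[o]m+o≡n 11s≤p))))
                                                    (cong (_+ᶻ + e) (ℤ.pos-* 11 s))))
                       (sub-add (+ 11 *ᶻ S) (+ e))

      factored-neg : ∀ p → factored (-ᶻ + p) ≤ᶻ + 0
      factored-neg p = ℤ.≤-trans
        (ℤ.≤-reflexive (trans (cong (λ y → -ᶻ + p *ᶻ y *ᶻ (z *ᶻ z)) second) (neg-left (+ p) (+ (11 * s + p)) (z *ᶻ z))))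
        (neg-product≤0 p (11 * s + p) z)
        where
        z : ℤ
        z = -ᶻ + p +ᶻ + 5 *ᶻ S
        second : + 11 *ᶻ S -ᶻ (-ᶻ + p) ≡ + (11 * s + p)
        second = cong₂ _+ᶻ_ (sym (ℤ.pos-* 11 s)) (ℤ.neg-involutive (+ p))

      pos-n : + n ≡ + 16 *ᶻ (S *ᶻ S)
      pos-n = trans (cong +_ (lem s)) (trans (ℤ.pos-* 16 (s * s)) (cong (+ 16 *ᶻ_) (ℤ.pos-* s s)))
        where
        lem : ∀ s → 4 * s * (4 * s) ≡ 16 * (s * s)
        lem = solve-∀

      pos-a : + a ≡ + 8 *ᶻ (S *ᶻ S) +ᶻ T
      pos-a = cong (_+ᶻ T) (trans (ℤ.pos-* 8 (s * s)) (cong (+ 8 *ᶻ_) (ℤ.pos-* s s)))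

      walk-excess : ∀ w d → length w ≡ n → + ones w ≡ + a +ᶻ d → walk (+ 0) w ≡ S +ᶻ (d +ᶻ d)
      walk-excess w d |w|≡n eq = begin
        walk (+ 0) w
          ≡⟨ walk-ones (+ 0) w ⟩
        + 0 +ᶻ + 2 *ᶻ + ones w -ᶻ + length w
          ≡⟨ cong₂ (λ x y → + 0 +ᶻ + 2 *ᶻ x -ᶻ y) (trans eq (cong (_+ᶻ d) pos-a)) (trans (cong +_ |w|≡n) pos-n) ⟩
        + 0 +ᶻ + 2 *ᶻ (+ 8 *ᶻ (S *ᶻ S) +ᶻ T +ᶻ d) -ᶻ + 16 *ᶻ (S *ᶻ S)
          ≡⟨ lem (S *ᶻ S) T d ⟩
        S +ᶻ (d +ᶻ d) ∎
        where
        open ≡-Reasoning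
        lem : ∀ x T d → + 0 +ᶻ + 2 *ᶻ (+ 8 *ᶻ x +ᶻ T +ᶻ d) -ᶻ + 16 *ᶻ x ≡ T +ᶻ T +ᶻ (d +ᶻ d)
        lem = ℤ.solve-∀

      neg-double : ∀ p → -ᶻ p +ᶻ -ᶻ p ≡ -ᶻ (p +ᶻ p)
      neg-double = ℤ.solve-∀

      cancel-neg : ∀ o p → o ≡ o +ᶻ p +ᶻ -ᶻ p
      cancel-neg = ℤ.solve-∀

      -- If the number of ones differs from `a` by `d`, the walk ends at `s + 2d`, so the sign of
      -- `d` decides between `factored-pos` and `factored-neg`.
      test≤ : ∀ w → length w ≡ n → test (walk (+ 0) w) ≤ᶻ + (cap * ⟦ a ≤? ones w ⟧)
      test≤ w |w|≡n with a ≤? ones w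
      ... | yes a≤o = ℤ.≤-trans
        (ℤ.≤-reflexive (trans (cong test (walk-excess w (+ p) |w|≡n (cong +_ (sym a+p≡o)))) (test-factor (+ (p + p)))))
        (ℤ.≤-trans (factored-pos (p + p)) (+≤+ (≤-reflexive (sym (*-identityʳ cap)))))
        where
        p : ℕ
        p = proj₁ (m≤n⇒∃[o]m+o≡n a≤o)
        a+p≡o : a + p ≡ ones w
        a+p≡o = proj₂ (m≤n⇒∃[o]m+o≡n a≤o)
      ... | no a≰o = ℤ.≤-trans
        (ℤ.≤-reflexive (trans (cong test (trans (walk-excess w (-ᶻ + p) |w|≡n excess) (cong (S +ᶻ_) (neg-double (+ p)))))
                              (test-factor (-ᶻ + (p + p)))))
        (ℤ.≤-trans (factored-neg (p + p)) (+≤+ z≤n))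
        where
        p : ℕ
        p = proj₁ (m≤n⇒∃[o]m+o≡n (<⇒≤ (≰⇒> a≰o)))
        excess : + ones w ≡ + a +ᶻ -ᶻ + p
        excess = trans (cancel-neg (+ ones w) (+ p))
                       (cong (λ z → + z +ᶻ -ᶻ + p) (proj₂ (m≤n⇒∃[o]m+o≡n (<⇒≤ (≰⇒> a≰o)))))

      -- The walk starts at 0, so the odd coefficients disappear. In units of `S⁴` the rest is
      -- `-192 + 76 · 16 - 3 · 16² = 16²`, apart from the term `+ 2 *ᶻ N` of the fourth moment.
      mean≡ : ∀ S → let N = + 16 *ᶻ (S *ᶻ S) in
        -ᶻ (+ 192 *ᶻ (S *ᶻ S *ᶻ S *ᶻ S)) +ᶻ + 112 *ᶻ (S *ᶻ S *ᶻ S) *ᶻ + 0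
          +ᶻ + 76 *ᶻ (S *ᶻ S) *ᶻ (+ 0 *ᶻ + 0 +ᶻ N)
          +ᶻ + 5 *ᶻ S *ᶻ (+ 0 *ᶻ + 0 *ᶻ + 0 +ᶻ + 3 *ᶻ N *ᶻ + 0)
          -ᶻ (+ 0 *ᶻ + 0 *ᶻ + 0 *ᶻ + 0 +ᶻ + 6 *ᶻ N *ᶻ (+ 0 *ᶻ + 0) +ᶻ + 3 *ᶻ N *ᶻ N -ᶻ + 2 *ᶻ N)
        ≡ N *ᶻ N +ᶻ + 2 *ᶻ N
      mean≡ = ℤ.solve-∀

      mean : quartic-mean (+ 5 *ᶻ S) (+ 76 *ᶻ (S *ᶻ S)) (+ 112 *ᶻ (S *ᶻ S *ᶻ S)) (-ᶻ (+ 192 *ᶻ (S *ᶻ S *ᶻ S *ᶻ S))) (+ n) (+ 0)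
             ≡ + (n * n + 2 * n)
      mean = trans (cong (λ N → quartic-mean (+ 5 *ᶻ S) (+ 76 *ᶻ (S *ᶻ S)) (+ 112 *ᶻ (S *ᶻ S *ᶻ S))
                                  (-ᶻ (+ 192 *ᶻ (S *ᶻ S *ᶻ S *ᶻ S))) N (+ 0)) pos-n)
            (trans (mean≡ S) (trans (cong (λ N → N *ᶻ N +ᶻ + 2 *ᶻ N) (sym pos-n))
                                    (cong₂ _+ᶻ_ (sym (ℤ.pos-* n n)) (sym (ℤ.pos-* 2 n)))))

    -- A function of mean at least `n²` that is at most `256 n²` times an indicator forces this
    -- indicator to have mean at least 1/256. The event is an excess of `t = √n / 8` ones over
    -- `n/2`.
    anti-concentration : .{{_ : NonZero t}} →
      2 ^ (4 * (t + t) * (4 * (t + t))) ≤ 256 * cnt (4 * (t + t) * (4 * (t + t))) (8 * ((t + t) * (t + t)) + t)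
    anti-concentration = *-cancelʳ-≤ _ _ (n * n) {{m*n≢0 n n {{n≢0}} {{n≢0}}}} (begin
      2 ^ n * (n * n)            ≤⟨ *-monoʳ-≤ (2 ^ n) (m≤m+n (n * n) (2 * n)) ⟩
      2 ^ n * (n * n + 2 * n)    ≤⟨ ℤ.drop‿+≤+ key ⟩
      cap * cnt n a              ≡⟨ lem r (cnt n a) ⟩
      256 * cnt n a * (n * n)    ∎)
      where
      open ≤-Reasoning
      n≢0 : NonZero n
      n≢0 = m*n≢0 r r {{r≢0}} {{r≢0}}
        where
        r≢0 : NonZero r
        r≢0 = m*n≢0 4 s {{_}} {{>-nonZero (≤-trans (>-nonZero⁻¹ t) (m≤m+n t t))}}
      lem : ∀ r c → 4 * r * (4 * r) * (4 * r * (4 * r)) * c ≡ 256 * c * (r * r * (r * r))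
      lem = solve-∀
      key : + (2 ^ n * (n * n + 2 * n)) ≤ᶻ + (cap * cnt n a)
      key = ℤ.≤-trans
        (ℤ.≤-reflexive (trans (ℤ.pos-* (2 ^ n) _)
          (trans (cong (+ (2 ^ n) *ᶻ_) (sym mean)) (sym (sumZ-quartic (+ 5 *ᶻ S) (+ 76 *ᶻ (S *ᶻ S)) (+ 112 *ᶻ (S *ᶻ S *ᶻ S))
                                                       (-ᶻ (+ 192 *ᶻ (S *ᶻ S *ᶻ S *ᶻ S))) n (+ 0))))))
        (ℤ.≤-trans (sumZ-mono n test≤)
          (ℤ.≤-reflexive (trans (sumZ-pos n _) (cong +_ (sumW-*ˡ n cap _)))))

open AntiConcentration using (anti-concentration)

-- Upper bound

cnt< : ℕ → ℕ → ℕ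
cnt< n a = sumW n (λ w → ⟦ ones w <? a ⟧)

cnt<+cnt : ∀ n a → cnt< n a + cnt n a ≡ 2 ^ n
cnt<+cnt n a = trans (sym (sumW-+ n _ _)) (trans (sumW-cong n λ w _ → one w) (sumW-1 n))
  where
  one : ∀ w → ⟦ ones w <? a ⟧ + ⟦ a ≤? ones w ⟧ ≡ 1
  one w with ones w <? a | a ≤? ones w
  ... | yes o<a | yes a≤o = contradiction a≤o (<⇒≱ o<a)
  ... | yes _   | no _    = refl
  ... | no _    | yes _   = refl
  ... | no o≮a  | no a≰o  = contradiction (≮⇒≥ o≮a) a≰o

ones-take-drop : ∀ m w → ones w ≡ ones (take m w) + ones (drop m w)
ones-take-drop zero    w           = refl
ones-take-drop (suc m) []          = refl
ones-take-drop (suc m) (true  ∷ w) = cong suc (ones-take-drop m w)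
ones-take-drop (suc m) (false ∷ w) = ones-take-drop m w

cnt-+ : ∀ m n a b → cnt m a * cnt n b ≤ cnt (m + n) (a + b)
cnt-+ m n a b = begin
  cnt m a * cnt n b
    ≡⟨ sym (sumW-take-drop m n (λ u → ⟦ a ≤? ones u ⟧) (λ v → ⟦ b ≤? ones v ⟧)) ⟩
  sumW (m + n) (λ w → ⟦ a ≤? ones (take m w) ⟧ * ⟦ b ≤? ones (drop m w) ⟧)
    ≤⟨ sumW-mono (m + n) (λ w _ → pointwise w) ⟩
  cnt (m + n) (a + b) ∎
  where
  open ≤-Reasoning
  pointwise : ∀ w → ⟦ a ≤? ones (take m w) ⟧ * ⟦ b ≤? ones (drop m w) ⟧ ≤ ⟦ a + b ≤? ones w ⟧
  pointwise w with a ≤? ones (take m w) | b ≤? ones (drop m w) | a + b ≤? ones w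
  ... | no _  | _     | _      = z≤n
  ... | yes _ | no _  | _      = z≤n
  ... | yes _ | yes _ | yes _  = ≤-refl
  ... | yes p | yes q | no ¬ab =
    contradiction (subst (a + b ≤_) (sym (ones-take-drop m w)) (+-mono-≤ p q)) ¬ab

-- Turns a constant probability into a moderate deviation: over `g` blocks the excesses add up,
-- which is √g times the typical fluctuation, at the price of a `g`-th power.
cnt-* : ∀ g n a → cnt n a ^ g ≤ cnt (g * n) (g * a)
cnt-* zero    n a = ≤-refl
cnt-* (suc g) n a = ≤-trans (*-monoʳ-≤ (cnt n a) (cnt-* g n a)) (cnt-+ n (g * n) a (g * a))

-- The indicator that `m` consecutive windows of length `k` are all light, written as a product so
-- that its sum factorises over the windows.
sparse : ℕ → ℕ → ℕ → List Bool → ℕ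
sparse k a zero    w = 1
sparse k a (suc m) w = ⟦ ones (take k w) <? a ⟧ * sparse k a m (drop k w)

sumW-sparse : ∀ k a m r → sumW (m * k + r) (sparse k a m) ≡ cnt< k a ^ m * 2 ^ r
sumW-sparse k a zero    r = trans (sumW-1 r) (sym (+-identityʳ (2 ^ r)))
sumW-sparse k a (suc m) r = begin
  sumW (k + m * k + r) (sparse k a (suc m))
    ≡⟨ cong (λ n → sumW n (sparse k a (suc m))) (+-assoc k (m * k) r) ⟩
  sumW (k + (m * k + r)) (sparse k a (suc m))
    ≡⟨ sumW-take-drop k (m * k + r) (λ u → ⟦ ones u <? a ⟧) (sparse k a m) ⟩
  cnt< k a * sumW (m * k + r) (sparse k a m)
    ≡⟨ cong (cnt< k a *_) (sumW-sparse k a m r) ⟩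
  cnt< k a * (cnt< k a ^ m * 2 ^ r)
    ≡⟨ sym (*-assoc (cnt< k a) _ _) ⟩
  cnt< k a ^ suc m * 2 ^ r ∎
  where open ≡-Reasoning

sparse≡1 : ∀ k a m w → (∀ j → j + k ≤ length w → ones (take k (drop j w)) < a) →
           m * k ≤ length w → sparse k a m w ≡ 1
sparse≡1 k a zero    w light mk≤ = refl
sparse≡1 k a (suc m) w light mk≤ with ones (take k w) <? a
... | no ≮a = contradiction (light 0 (≤-trans (m≤m+n k (m * k)) mk≤)) ≮a
... | yes _ = trans (+-identityʳ _) (sparse≡1 k a m (drop k w) light′ mk≤′)
  where
  |w| : length (drop k w) ≡ length w ∸ k
  |w| = length-drop k w
  mk≤′ : m * k ≤ length (drop k w)
  mk≤′ = subst₂ _≤_ (m+n∸m≡n k (m * k)) (sym |w|) (∸-monoˡ-≤ k mk≤)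
  light′ : ∀ j → j + k ≤ length (drop k w) → ones (take k (drop j (drop k w))) < a
  light′ j j+k≤ rewrite drop-drop k j w = light (k + j) (begin
    k + j + k             ≡⟨ +-assoc k j k ⟩
    k + (j + k)           ≤⟨ +-monoʳ-≤ k (subst (j + k ≤_) |w| j+k≤) ⟩
    k + (length w ∸ k)    ≡⟨ m+[n∸m]≡n (≤-trans (m≤m+n k (m * k)) mk≤) ⟩
    length w              ∎)
    where open ≤-Reasoning

-- A window is light with probability at most `1 - 1/M`, and `W * M` independent windows bring this
-- down to `2^-W`. The pattern rebinds `M` to the predecessor, the base required by `growth`.
sparse-rare : ∀ k a M W m {n} → 2 ≤ M → 2 ^ k ≤ M * cnt k a → W * M ≤ m → m * k ≤ n →
              2 ^ W * sumW n (sparse k a m) ≤ 2 ^ n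
sparse-rare k a (suc M@(suc _)) W m (s≤s (s≤s _)) dense WM≤m mk≤n with m≤n⇒∃[o]m+o≡n mk≤n
... | r , refl = begin
  2 ^ W * sumW (m * k + r) (sparse k a m)   ≡⟨ cong (2 ^ W *_) (sumW-sparse k a m r) ⟩
  2 ^ W * (cnt< k a ^ m * 2 ^ r)            ≡⟨ sym (*-assoc (2 ^ W) _ _) ⟩
  2 ^ W * cnt< k a ^ m * 2 ^ r              ≤⟨ *-monoˡ-≤ (2 ^ r) rare ⟩
  2 ^ (m * k) * 2 ^ r                       ≡⟨ sym (^-distribˡ-+-* 2 (m * k) r) ⟩
  2 ^ (m * k + r)                           ∎
  where
  open ≤-Reasoning
  b : ℕ
  b = cnt< k a
  density : b * suc M ≤ 2 ^ k * M
  density = +-cancelʳ-≤ (2 ^ k) _ _ (begin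
    b * suc M + 2 ^ k                ≤⟨ +-monoʳ-≤ (b * suc M) dense ⟩
    b * suc M + suc M * cnt k a      ≡⟨ lem b (suc M) (cnt k a) ⟩
    (b + cnt k a) * suc M            ≡⟨ cong (_* suc M) (cnt<+cnt k a) ⟩
    2 ^ k * suc M                    ≡⟨ trans (*-suc (2 ^ k) M) (+-comm (2 ^ k) _) ⟩
    2 ^ k * M + 2 ^ k                ∎)
    where
    lem : ∀ b s c → b * s + s * c ≡ (b + c) * s
    lem = solve-∀
  rare : 2 ^ W * b ^ m ≤ 2 ^ (m * k)
  rare = *-cancelʳ-≤ _ _ (suc M ^ m) {{m^n≢0 (suc M) m}} (begin
    2 ^ W * b ^ m * suc M ^ m        ≡⟨ *-assoc (2 ^ W) _ _ ⟩
    2 ^ W * (b ^ m * suc M ^ m)      ≡⟨ cong (2 ^ W *_) (sym ([x*y]^n b (suc M) m)) ⟩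
    2 ^ W * (b * suc M) ^ m          ≤⟨ *-monoʳ-≤ (2 ^ W) (^-monoˡ-≤ m density) ⟩
    2 ^ W * (2 ^ k * M) ^ m          ≡⟨ cong (2 ^ W *_) ([x*y]^n (2 ^ k) M m) ⟩
    2 ^ W * ((2 ^ k) ^ m * M ^ m)    ≡⟨ lem (2 ^ W) ((2 ^ k) ^ m) (M ^ m) ⟩
    (2 ^ k) ^ m * (2 ^ W * M ^ m)    ≤⟨ *-monoʳ-≤ ((2 ^ k) ^ m)
                                          (growth M W (≤-trans (*-monoʳ-≤ W (n≤1+n M)) WM≤m)) ⟩
    (2 ^ k) ^ m * suc M ^ m          ≡⟨ cong (_* suc M ^ m)
                                          (trans (^-*-assoc 2 k m) (cong (2 ^_) (*-comm k m))) ⟩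
    2 ^ (m * k) * suc M ^ m          ∎)
    where
    lem : ∀ x y z → x * (y * z) ≡ y * (x * z)
    lem = solve-∀

-- Exponential tilting over the scales.

-- Each of the `δ + d` pairs of letters costs a factor `(2q + 1)² / (4q(q + 1)) = 1 + 1/Q`, in total
-- at most `2 ^ h`. The surplus of ones yields `((q + 1)/q)^δ`, which is at least `2 ^ (h * 2)`.
level-gain : ∀ q .{{_ : NonZero q}} h δ d y → h * 2 * q ≤ δ → δ + d ≤ h * y → 2 * y ≤ 4 * (q * suc q) →
             2 ^ h * (q + suc q) ^ (δ + d + δ + d) ≤ 2 ^ (δ + d + δ + d) * (suc q ^ (δ + d + δ) * q ^ d)
level-gain q h δ d y 2hq≤δ m≤hy 2y≤Q = *-cancelʳ-≤ _ _ (q ^ δ) {{m^n≢0 q δ}} (begin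
  2 ^ h * (q + suc q) ^ (m + δ + d) * q ^ δ
    ≡⟨ cong (λ e → 2 ^ h * (q + suc q) ^ e * q ^ δ) m+m ⟩
  2 ^ h * (q + suc q) ^ (2 * m) * q ^ δ
    ≡⟨ cong (λ e → 2 ^ h * e * q ^ δ) (trans (sym (^-*-assoc (q + suc q) 2 m)) (cong (_^ m) (sq q))) ⟩
  2 ^ h * suc Q ^ m * q ^ δ
    ≤⟨ *-monoˡ-≤ (q ^ δ) (*-monoʳ-≤ (2 ^ h) (slow-growth Q {{Q≢0}} y h 2y≤Q m≤hy)) ⟩
  2 ^ h * (2 ^ h * Q ^ m) * q ^ δ
    ≡⟨ lem₁ (2 ^ h) (Q ^ m) (q ^ δ) ⟩
  Q ^ m * (2 ^ h * 2 ^ h * q ^ δ)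
    ≡⟨ cong (λ e → Q ^ m * (e * q ^ δ)) (trans (sym (^-distribˡ-+-* 2 h h)) (cong (2 ^_) (lem₂ h))) ⟩
  Q ^ m * (2 ^ (h * 2) * q ^ δ)
    ≤⟨ *-monoʳ-≤ (Q ^ m) (growth q (h * 2) 2hq≤δ) ⟩
  Q ^ m * suc q ^ δ
    ≡⟨ cong (_* suc q ^ δ) (trans ([x*y]^n 4 (q * suc q) m)
         (cong₂ _*_ (trans (^-*-assoc 2 2 m) (cong (2 ^_) (sym m+m))) ([x*y]^n q (suc q) m))) ⟩
  2 ^ (m + δ + d) * (q ^ m * suc q ^ m) * suc q ^ δ
    ≡⟨ cong (λ e → 2 ^ (m + δ + d) * (e * suc q ^ m) * suc q ^ δ) (^-distribˡ-+-* q δ d) ⟩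
  2 ^ (m + δ + d) * (q ^ δ * q ^ d * suc q ^ m) * suc q ^ δ
    ≡⟨ lem₃ (2 ^ (m + δ + d)) (q ^ δ) (q ^ d) (suc q ^ m) (suc q ^ δ) ⟩
  2 ^ (m + δ + d) * (suc q ^ m * suc q ^ δ * q ^ d) * q ^ δ
    ≡⟨ cong (λ e → 2 ^ (m + δ + d) * (e * q ^ d) * q ^ δ) (sym (^-distribˡ-+-* (suc q) m δ)) ⟩
  2 ^ (m + δ + d) * (suc q ^ (m + δ) * q ^ d) * q ^ δ ∎)
  where
  open ≤-Reasoning
  m Q : ℕ
  m = δ + d
  Q = 4 * (q * suc q)
  Q≢0 : NonZero Q
  Q≢0 = m*n≢0 4 (q * suc q) {{_}} {{m*n≢0 q (suc q)}}
  m+m : m + δ + d ≡ 2 * m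
  m+m = lem δ d
    where
    lem : ∀ δ d → δ + d + δ + d ≡ 2 * (δ + d)
    lem = solve-∀
  sq : ∀ q → (q + suc q) * ((q + suc q) * 1) ≡ suc (4 * (q * suc q))
  sq = solve-∀
  lem₁ : ∀ x y z → x * (x * y) * z ≡ y * (x * x * z)
  lem₁ = solve-∀
  lem₂ : ∀ h → h + h ≡ h * 2
  lem₂ = solve-∀
  lem₃ : ∀ p a b c e → p * (a * b * c) * e ≡ p * (c * e * b) * a
  lem₃ = solve-∀

^-cross : ∀ a b c d e → a * d ≤ c * b → a ^ e * d ^ e ≤ c ^ e * b ^ e
^-cross a b c d e ad≤cb = subst₂ _≤_ ([x*y]^n a d e) ([x*y]^n c b e) (^-monoˡ-≤ e ad≤cb)

module Tilting (α ω q : ℕ → ℕ) (q>0 : ∀ l → 0 < q l) (q-mono : ∀ l → q l ≤ q (suc l)) where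

  len K A : ℕ → ℕ
  len l = α l + ω l
  K zero    = 0
  K (suc i) = K i + len i
  A zero    = 0
  A (suc i) = A i + α i

  K-mono : ∀ {l i} → l ≤ i → K l ≤ K i
  K-mono {zero}           _         = z≤n
  K-mono {suc l} {suc i} 1+l≤1+i with m≤n⇒m<n∨m≡n 1+l≤1+i
  ... | inj₁ (s≤s 1+l≤i) = ≤-trans (K-mono 1+l≤i) (m≤m+n (K i) _)
  ... | inj₂ refl        = ≤-refl

  tilted : ℕ → List Bool → ℕ
  tilted l = wt (λ _ → tilt (suc (q l)) (q l))

  T : ℕ → List Bool → ℕ
  T zero    w = 1
  T (suc i) w = T i (take (K i) w) * tilted i (drop (K i) w)

  -- The value of `T i` on a word whose block `l` has exactly `α l` ones and `ω l` zeros; it is the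
  -- benchmark for the rich words.
  C : ℕ → ℕ
  C zero    = 1
  C (suc i) = C i * (suc (q i) ^ α i * q i ^ ω i)

  C≢0 : ∀ i → NonZero (C i)
  C≢0 zero    = _
  C≢0 (suc i) = m*n≢0 (C i) _ {{C≢0 i}} {{m*n≢0 _ _ {{m^n≢0 (suc (q i)) (α i)}}
                  {{m^n≢0 (q i) (ω i) {{>-nonZero (q>0 i)}}}}}}

  -- The mean of `T i` falls short of the benchmark `C i` by `2 ^ h` for every scale. As `C≤T` puts
  -- rich words above the benchmark, Markov's inequality makes them rare.
  sumW-T : ∀ h i → (∀ l → l < i → 2 ^ h * (q l + suc (q l)) ^ len l ≤ 2 ^ len l * (suc (q l) ^ α l * q l ^ ω l)) →
           2 ^ (i * h) * sumW (K i) (T i) ≤ 2 ^ K i * C i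
  sumW-T h zero    gain = ≤-refl
  sumW-T h (suc i) gain = begin
    2 ^ (h + i * h) * sumW (K i + len i) (T (suc i))
      ≡⟨ cong₂ _*_ (^-distribˡ-+-* 2 h (i * h)) (trans (sumW-take-drop (K i) (len i) (T i) (tilted i))
           (cong (sumW (K i) (T i) *_) (trans (sumW-wt (len i) _) (prod-const (len i) _)))) ⟩
    2 ^ h * 2 ^ (i * h) * (sumW (K i) (T i) * (q i + suc (q i)) ^ len i)
      ≡⟨ lem (2 ^ h) (2 ^ (i * h)) (sumW (K i) (T i)) _ ⟩
    2 ^ (i * h) * sumW (K i) (T i) * (2 ^ h * (q i + suc (q i)) ^ len i)
      ≤⟨ *-mono-≤ (sumW-T h i λ l l<i → gain l (m≤n⇒m≤1+n l<i)) (gain i ≤-refl) ⟩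
    2 ^ K i * C i * (2 ^ len i * (suc (q i) ^ α i * q i ^ ω i))
      ≡⟨ *-interchange (2 ^ K i) _ _ _ ⟩
    2 ^ K i * 2 ^ len i * C (suc i)
      ≡⟨ cong (_* C (suc i)) (sym (^-distribˡ-+-* 2 (K i) (len i))) ⟩
    2 ^ K (suc i) * C (suc i) ∎
    where
    open ≤-Reasoning
    lem : ∀ a b c d → a * b * (c * d) ≡ b * c * (a * d)
    lem = solve-∀

  Rich : ℕ → List Bool → Set
  Rich i w = ∀ l → l < i → A (suc l) ≤ ones (take (K (suc l)) w)

  -- Summation by parts: since the tilts (1 + q)/q decrease, an excess of ones over A i at
  -- scale i is worth at least as much at the current tilt as at the next one.
  T-excess : ∀ i w → length w ≡ K i → Rich i w →
             Σ ℕ λ ρ → ones w ≡ A i + ρ × suc (q i) ^ ρ * C i ≤ T i w * q i ^ ρ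
  T-excess zero    []  _    rich = 0 , refl , ≤-refl
  T-excess (suc i) w   |w|  rich with T-excess i u |u| rich-u | zeros v
    where
    u v : List Bool
    u = take (K i) w
    v = drop (K i) w
    |u| : length u ≡ K i
    |u| = length-take-≤ (K i) w (subst (K i ≤_) (sym |w|) (m≤m+n (K i) (len i)))
    rich-u : Rich i u
    rich-u l l<i = subst (λ x → A (suc l) ≤ ones x)
      (trans (cong (λ k → take k w) (sym (m≤n⇒m⊓n≡m (K-mono l<i)))) (sym (take-take (K (suc l)) (K i) w)))
      (rich l (m≤n⇒m≤1+n l<i))
  ... | ρ , ones-u , IH | ζ , Δ+ζ = ρ′ , sym ones-w , next
    where
    open ≤-Reasoning
    u v : List Bool
    u = take (K i) w
    v = drop (K i) w
    a b : ℕ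
    a = suc (q i)
    b = q i
    total-ones : ones w ≡ A i + ρ + ones v
    total-ones = trans (ones-take-drop (K i) w) (cong (_+ ones v) ones-u)
    A≤ones : A i + α i ≤ ones w
    A≤ones = subst (λ x → A (suc i) ≤ ones x) (take-all (K (suc i)) w (≤-reflexive |w|)) (rich i ≤-refl)
    -- Richness at this scale makes the new excess a natural number; for a negative one, passing to
    -- the weaker tilt in `next` would go the wrong way.
    ρ′ : ℕ
    ρ′ = proj₁ (m≤n⇒∃[o]m+o≡n A≤ones)
    ones-w : A i + α i + ρ′ ≡ ones w
    ones-w = proj₂ (m≤n⇒∃[o]m+o≡n A≤ones)
    ρ+Δ : ρ + ones v ≡ α i + ρ′
    ρ+Δ = +-cancelˡ-≡ (A i) _ _ (trans (sym (+-assoc (A i) ρ _))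
            (trans (sym total-ones) (trans (sym ones-w) (+-assoc (A i) _ _))))
    |v| : ones v + ζ ≡ α i + ω i
    |v| = trans Δ+ζ (trans (length-drop (K i) w) (trans (cong (_∸ K i) |w|) (m+n∸m≡n (K i) (len i))))
    ζ+ρ′ : ζ + ρ′ ≡ ω i + ρ
    ζ+ρ′ = +-cancelˡ-≡ (ones v + α i) _ _
      (trans (lem₁ (ones v) (α i) ζ ρ′) (trans (cong₂ _+_ |v| (sym ρ+Δ)) (lem₂ (α i) (ω i) ρ (ones v))))
      where
      lem₁ : ∀ o a z r → o + a + (z + r) ≡ (o + z) + (a + r)
      lem₁ = solve-∀
      lem₂ : ∀ a w r o → (a + w) + (r + o) ≡ o + a + (w + r)
      lem₂ = solve-∀
    same : a ^ ρ′ * C (suc i) ≤ T (suc i) w * b ^ ρ′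
    same = begin
      a ^ ρ′ * (C i * (a ^ α i * b ^ ω i))
        ≡⟨ lem₁ (a ^ ρ′) (C i) (a ^ α i) (b ^ ω i) ⟩
      a ^ α i * a ^ ρ′ * (C i * b ^ ω i)
        ≡⟨ cong (_* (C i * b ^ ω i)) (trans (sym (^-distribˡ-+-* a (α i) ρ′))
             (trans (cong (a ^_) (sym ρ+Δ)) (^-distribˡ-+-* a ρ (ones v)))) ⟩
      a ^ ρ * a ^ ones v * (C i * b ^ ω i)
        ≡⟨ lem₂ (a ^ ρ) (a ^ ones v) (C i) (b ^ ω i) ⟩
      a ^ ρ * C i * (a ^ ones v * b ^ ω i)
        ≤⟨ *-monoˡ-≤ _ IH ⟩
      T i u * b ^ ρ * (a ^ ones v * b ^ ω i)
        ≡⟨ lem₃ (T i u) (b ^ ρ) (a ^ ones v) (b ^ ω i) ⟩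
      T i u * a ^ ones v * (b ^ ω i * b ^ ρ)
        ≡⟨ cong (T i u * a ^ ones v *_) (trans (sym (^-distribˡ-+-* b (ω i) ρ))
             (trans (cong (b ^_) (sym ζ+ρ′)) (^-distribˡ-+-* b ζ ρ′))) ⟩
      T i u * a ^ ones v * (b ^ ζ * b ^ ρ′)
        ≡⟨ lem₄ (T i u) (a ^ ones v) (b ^ ζ) (b ^ ρ′) ⟩
      T i u * (a ^ ones v * b ^ ζ) * b ^ ρ′
        ≡⟨ cong (λ x → T i u * x * b ^ ρ′) (sym (wt-tilt a b v ζ Δ+ζ)) ⟩
      T i u * tilted i v * b ^ ρ′ ∎
      where
      lem₁ : ∀ r c x y → r * (c * (x * y)) ≡ x * r * (c * y)
      lem₁ = solve-∀
      lem₂ : ∀ r o c y → r * o * (c * y) ≡ r * c * (o * y)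
      lem₂ = solve-∀
      lem₃ : ∀ t r o y → t * r * (o * y) ≡ t * o * (y * r)
      lem₃ = solve-∀
      lem₄ : ∀ t o z r → t * o * (z * r) ≡ t * (o * z) * r
      lem₄ = solve-∀
    a′ b′ : ℕ
    a′ = suc (q (suc i))
    b′ = q (suc i)
    next : a′ ^ ρ′ * C (suc i) ≤ T (suc i) w * b′ ^ ρ′
    next = *-cancelʳ-≤ _ _ (b ^ ρ′) {{m^n≢0 b ρ′ {{>-nonZero (q>0 i)}}}} (begin
      a′ ^ ρ′ * C (suc i) * b ^ ρ′
        ≡⟨ lem₁ (a′ ^ ρ′) (C (suc i)) (b ^ ρ′) ⟩
      a′ ^ ρ′ * b ^ ρ′ * C (suc i)
        ≤⟨ *-monoˡ-≤ (C (suc i)) (^-cross a′ b′ a b ρ′ ratio) ⟩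
      a ^ ρ′ * b′ ^ ρ′ * C (suc i)
        ≡⟨ lem₁ (a ^ ρ′) (b′ ^ ρ′) (C (suc i)) ⟩
      a ^ ρ′ * C (suc i) * b′ ^ ρ′
        ≤⟨ *-monoˡ-≤ (b′ ^ ρ′) same ⟩
      T (suc i) w * b ^ ρ′ * b′ ^ ρ′
        ≡⟨ lem₁ (T (suc i) w) (b ^ ρ′) (b′ ^ ρ′) ⟩
      T (suc i) w * b′ ^ ρ′ * b ^ ρ′ ∎)
      where
      lem₁ : ∀ x y z → x * y * z ≡ x * z * y
      lem₁ = solve-∀
      ratio : a′ * b ≤ a * b′
      ratio = +-mono-≤ (q-mono i) (≤-reflexive (*-comm b′ b))

  C≤T : ∀ i w → length w ≡ K i → Rich i w → C i ≤ T i w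
  C≤T i w |w| rich with T-excess i w |w| rich
  ... | ρ , _ , le = *-cancelʳ-≤ _ _ (q i ^ ρ) {{m^n≢0 (q i) ρ {{>-nonZero (q>0 i)}}}} (begin
    C i * q i ^ ρ          ≤⟨ *-monoʳ-≤ (C i) (^-monoˡ-≤ ρ (n≤1+n (q i))) ⟩
    C i * suc (q i) ^ ρ    ≡⟨ *-comm (C i) _ ⟩
    suc (q i) ^ ρ * C i    ≤⟨ le ⟩
    T i w * q i ^ ρ        ∎)
    where open ≤-Reasoning

  module _ (I m n : ℕ) (K≤n : K I ≤ n) (mK≤n : ∀ l → l < I → m * K (suc l) ≤ n) where

    bad : List Bool → ℕ
    bad w = sumN I (λ l → sparse (K (suc l)) (A (suc l)) m w)

    -- If the prefix is light at some scale, prefix normality makes every window of that length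
    -- light, so a term of `bad` is 1. Otherwise the word is rich and `C≤T` applies. The factor
    -- `C I` clears the denominator of `T / C`.
    prefixNormal-cover : ∀ w → length w ≡ n → ⟦ prefixNormal? w ⟧ * C I ≤ T I (take (K I) w) + C I * bad w
    prefixNormal-cover w |w| with prefixNormal? w
    ... | no _   = z≤n
    ... | yes pn with anyUpTo? (λ l → ones (take (K (suc l)) w) <? A (suc l)) I
    ...   | yes (l , l<I , light) = begin
      C I + 0                      ≡⟨ trans (+-identityʳ (C I)) (sym (*-identityʳ (C I))) ⟩
      C I * 1                      ≡⟨ cong (C I *_) (sym (sparse≡1 (K (suc l)) (A (suc l)) m w
                                        (λ j j≤ → ≤-<-trans (pn (K (suc l)) j j≤) light)
                                        (subst (m * K (suc l) ≤_) (sym |w|) (mK≤n l l<I)))) ⟩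
      C I * sparse _ _ m w         ≤⟨ *-monoʳ-≤ (C I) (term≤sumN I _ l<I) ⟩
      C I * bad w                  ≤⟨ m≤n+m _ (T I (take (K I) w)) ⟩
      T I (take (K I) w) + C I * bad w ∎
      where open ≤-Reasoning
    ...   | no all-rich = begin
      C I + 0                      ≡⟨ +-identityʳ (C I) ⟩
      C I                          ≤⟨ C≤T I (take (K I) w) (length-take-≤ (K I) w (subst (K I ≤_) (sym |w|) K≤n)) rich ⟩
      T I (take (K I) w)           ≤⟨ m≤m+n _ _ ⟩
      T I (take (K I) w) + C I * bad w ∎
      where
      open ≤-Reasoning
      rich : Rich I (take (K I) w)
      rich l l<I = subst (λ x → A (suc l) ≤ ones x)
        (trans (cong (λ k → take k w) (sym (m≤n⇒m⊓n≡m (K-mono l<I)))) (sym (take-take (K (suc l)) (K I) w)))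
        (≮⇒≥ λ light → all-rich (l , l<I , light))

    P-bound : P n * C I ≤ sumW (K I) (T I) * 2 ^ (n ∸ K I) + C I * sumN I (λ l → sumW n (sparse (K (suc l)) (A (suc l)) m))
    P-bound = begin
      P n * C I
        ≡⟨ trans (*-comm (P n) (C I)) (trans (cong (C I *_) (P≡sumW n)) (sym (sumW-*ˡ n (C I) _))) ⟩
      sumW n (λ w → C I * ⟦ prefixNormal? w ⟧)
        ≤⟨ sumW-mono n (λ w |w| → ≤-trans (≤-reflexive (*-comm (C I) _)) (prefixNormal-cover w |w|)) ⟩
      sumW n (λ w → T I (take (K I) w) + C I * bad w)
        ≡⟨ trans (sumW-+ n _ _) (cong₂ _+_ prefix (trans (sumW-*ˡ n (C I) bad) (cong (C I *_) (sumW-sumN n I _)))) ⟩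
      sumW (K I) (T I) * 2 ^ (n ∸ K I) + C I * sumN I (λ l → sumW n (sparse (K (suc l)) (A (suc l)) m)) ∎
      where
      open ≤-Reasoning
      prefix : sumW n (λ w → T I (take (K I) w)) ≡ sumW (K I) (T I) * 2 ^ (n ∸ K I)
      prefix = trans (cong (λ k → sumW k (λ w → T I (take (K I) w))) (sym (m+[n∸m]≡n K≤n)))
        (trans (sumW-cong (K I + (n ∸ K I)) (λ w _ → sym (*-identityʳ _)))
          (trans (sumW-take-drop (K I) (n ∸ K I) (T I) (λ _ → 1))
            (cong (sumW (K I) (T I) *_) (sumW-1 (n ∸ K I)))))

-- Choice of the scales, and the upper bound.

cnt-dense : ∀ t .{{_ : NonZero t}} g →
            2 ^ (64 * g * (t * t)) ≤ 2 ^ (8 * g) * cnt (64 * g * (t * t)) (g * (32 * (t * t) + t))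
cnt-dense t g = begin
  2 ^ (64 * g * (t * t))        ≡⟨ cong (2 ^_) (gb t g) ⟩
  2 ^ (b * g)                   ≡⟨ sym (^-*-assoc 2 b g) ⟩
  (2 ^ b) ^ g                   ≤⟨ ^-monoˡ-≤ g (anti-concentration t) ⟩
  (256 * cnt b a) ^ g           ≡⟨ [x*y]^n 256 (cnt b a) g ⟩
  256 ^ g * cnt b a ^ g         ≡⟨ cong (_* cnt b a ^ g) (^-*-assoc 2 8 g) ⟩
  2 ^ (8 * g) * cnt b a ^ g     ≤⟨ *-monoʳ-≤ (2 ^ (8 * g)) (cnt-* g b a) ⟩
  2 ^ (8 * g) * cnt (g * b) (g * a)
    ≡⟨ cong (2 ^ (8 * g) *_) (cong₂ cnt (trans (*-comm g b) (sym (gb t g))) (cong (g *_) (ga t))) ⟩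
  2 ^ (8 * g) * cnt (64 * g * (t * t)) (g * (32 * (t * t) + t)) ∎
  where
  open ≤-Reasoning
  b a : ℕ
  b = 4 * (t + t) * (4 * (t + t))
  a = 8 * ((t + t) * (t + t)) + t
  gb : ∀ t g → 64 * g * (t * t) ≡ 4 * (t + t) * (4 * (t + t)) * g
  gb = solve-∀
  ga : ∀ t → 8 * ((t + t) * (t + t)) + t ≡ 32 * (t * t) + t
  ga = solve-∀

-- Prefix length K (l + 1) = 64 g 4ˡ is required to contain A (l + 1) = g (32 · 4ˡ + 2ˡ) ones.
module Scales (h : ℕ) where

  -- With `κ * 2 ^ l` for `q l`, `δ-large` at positive scales asks for `4 κ h ≤ g`, and `half-small`
  -- at scale zero for `16 g ≤ κ² h`. Hence κ is at least 64; κ = 64 and `g = 256 h` turn both into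
  -- equalities.
  g : ℕ
  g = 256 * h

  -- Block `l` has `2 * half l` letters, of which the benchmark has `half l + δ l` ones and `ω l`
  -- zeros.
  δ half ω q : ℕ → ℕ
  δ zero       = g
  δ (suc l)    = g * 2 ^ l
  half zero    = 32 * g
  half (suc l) = 96 * g * (2 ^ l * 2 ^ l)
  ω l = half l ∸ δ l
  q l = 64 * 2 ^ l

  δ≤half : ∀ l → δ l ≤ half l
  δ≤half zero    = m≤m+n g (31 * g)
  δ≤half (suc l) = *-mono-≤ (m≤m+n g (95 * g)) (m≤m*n (2 ^ l) (2 ^ l) {{m^n≢0 2 l}})

  δ+ω : ∀ l → δ l + ω l ≡ half l
  δ+ω l = m+[n∸m]≡n (δ≤half l)

  q≢0 : ∀ l → NonZero (q l)
  q≢0 l = m*n≢0 64 (2 ^ l) {{_}} {{m^n≢0 2 l}}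

  open Tilting (λ l → δ l + ω l + δ l) ω q (λ l → >-nonZero⁻¹ (q l) {{q≢0 l}})
               (λ l → *-monoʳ-≤ 64 (^-monoʳ-≤ 2 (n≤1+n l))) public

  K≡ : ∀ l → K (suc l) ≡ 64 * g * (2 ^ l * 2 ^ l)
  K≡ zero = begin
    δ 0 + ω 0 + δ 0 + ω 0     ≡⟨ +-assoc (δ 0 + ω 0) (δ 0) (ω 0) ⟩
    δ 0 + ω 0 + (δ 0 + ω 0)   ≡⟨ cong₂ _+_ (δ+ω 0) (δ+ω 0) ⟩
    32 * g + 32 * g           ≡⟨ lem g ⟩
    64 * g * (1 * 1)          ∎
    where
    open ≡-Reasoning
    lem : ∀ g → 32 * g + 32 * g ≡ 64 * g * (1 * 1)
    lem = solve-∀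
  K≡ (suc l) = begin
    K (suc l) + (δ (suc l) + ω (suc l) + δ (suc l) + ω (suc l))
      ≡⟨ cong₂ _+_ (K≡ l) (trans (+-assoc (δ (suc l) + ω (suc l)) _ _) (cong₂ _+_ (δ+ω (suc l)) (δ+ω (suc l)))) ⟩
    64 * g * (2 ^ l * 2 ^ l) + (96 * g * (2 ^ l * 2 ^ l) + 96 * g * (2 ^ l * 2 ^ l))
      ≡⟨ lem g (2 ^ l) ⟩
    64 * g * (2 * 2 ^ l * (2 * 2 ^ l)) ∎
    where
    open ≡-Reasoning
    lem : ∀ g t → 64 * g * (t * t) + (96 * g * (t * t) + 96 * g * (t * t)) ≡ 64 * g * (2 * t * (2 * t))
    lem = solve-∀

  A≡ : ∀ l → A (suc l) ≡ g * (32 * (2 ^ l * 2 ^ l) + 2 ^ l)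
  A≡ zero = trans (cong (_+ δ 0) (δ+ω 0)) (lem g)
    where
    lem : ∀ g → 32 * g + g ≡ g * (32 * (1 * 1) + 1)
    lem = solve-∀
  A≡ (suc l) = trans (cong₂ _+_ (A≡ l) (cong (_+ δ (suc l)) (δ+ω (suc l)))) (lem g (2 ^ l))
    where
    lem : ∀ g t → g * (32 * (t * t) + t) + (96 * g * (t * t) + g * t) ≡ g * (32 * (2 * t * (2 * t)) + 2 * t)
    lem = solve-∀

  y : ℕ → ℕ
  y l = 2 * (q l * q l)

  δ-large : ∀ l → h * 2 * q l ≤ δ l
  δ-large zero    = subst₂ _≤_ (lem h) refl (*-monoˡ-≤ h (≤ᵇ⇒≤ 128 256 _))
    where
    lem : ∀ h → 128 * h ≡ h * 2 * (64 * 1)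
    lem = solve-∀
  δ-large (suc l) = ≤-reflexive (lem h (2 ^ l))
    where
    lem : ∀ h t → h * 2 * (64 * (2 * t)) ≡ 256 * h * t
    lem = solve-∀

  half-small : ∀ l → half l ≤ h * y l
  half-small zero    = ≤-reflexive (lem h)
    where
    lem : ∀ h → 32 * (256 * h) ≡ h * (2 * (64 * 1 * (64 * 1)))
    lem = solve-∀
  half-small (suc l) = ≤-trans (*-monoˡ-≤ (2 ^ l * 2 ^ l) (*-monoˡ-≤ g (≤ᵇ⇒≤ 96 128 _))) (≤-reflexive (lem h (2 ^ l)))
    where
    lem : ∀ h t → 128 * (256 * h) * (t * t) ≡ h * (2 * (64 * (2 * t) * (64 * (2 * t))))
    lem = solve-∀

  gain : ∀ l → 2 ^ h * (q l + suc (q l)) ^ len l ≤ 2 ^ len l * (suc (q l) ^ (δ l + ω l + δ l) * q l ^ ω l)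
  gain l = level-gain (q l) {{q≢0 l}} h (δ l) (ω l) (y l) (δ-large l)
             (subst (_≤ h * y l) (sym (δ+ω l)) (half-small l))
             (≤-trans (≤-reflexive (lem (q l))) (*-monoʳ-≤ 4 (*-monoʳ-≤ (q l) (n≤1+n (q l)))))
    where
    lem : ∀ q → 2 * (2 * (q * q)) ≡ 4 * (q * q)
    lem = solve-∀

  module _ .{{_ : NonZero h}} {n : ℕ} (big : 2 ^ (2068 * h) ≤ n) where

    -- The summand `h` in `W` pays for the sum over the `h` scales, as `h ≤ 2 ^ h`. A window reaches
    -- its quota of ones with probability at least `2^-(8g)`, so `sparse-rare` asks for `m` windows.
    W m : ℕ
    W = h * h + h
    m = W * 2 ^ (8 * g)

    -- The budget `2068 h = 3h + 8 · 256h + 15h + 2h` covers, in this order, `W`, the factor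
    -- `2 ^ (8 * g)`, `64 * g` and `2 ^ l * 2 ^ l`.
    mK≤n : ∀ l → l < h → m * K (suc l) ≤ n
    mK≤n l l<h = begin
      W * 2 ^ (8 * g) * K (suc l)
        ≡⟨ cong (m *_) (K≡ l) ⟩
      W * 2 ^ (8 * g) * (64 * g * (2 ^ l * 2 ^ l))
        ≤⟨ *-mono-≤ (*-monoˡ-≤ (2 ^ (8 * g)) W≤) (*-mono-≤ 64g≤ (*-mono-≤ l≤ l≤)) ⟩
      2 ^ (3 * h) * 2 ^ (8 * g) * (2 ^ (15 * h) * (2 ^ h * 2 ^ h))
        ≡⟨ collect ⟩
      2 ^ (3 * h + 8 * g + (15 * h + (h + h)))
        ≡⟨ cong (2 ^_) (lem h) ⟩
      2 ^ (2068 * h)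
        ≤⟨ big ⟩
      n ∎
      where
      open ≤-Reasoning
      lem : ∀ h → 3 * h + 8 * (256 * h) + (15 * h + (h + h)) ≡ 2068 * h
      lem = solve-∀
      collect : 2 ^ (3 * h) * 2 ^ (8 * g) * (2 ^ (15 * h) * (2 ^ h * 2 ^ h)) ≡ 2 ^ (3 * h + 8 * g + (15 * h + (h + h)))
      collect = sym (trans (^-distribˡ-+-* 2 (3 * h + 8 * g) _)
        (cong₂ _*_ (^-distribˡ-+-* 2 (3 * h) _)
          (trans (^-distribˡ-+-* 2 (15 * h) _) (cong (2 ^ (15 * h) *_) (^-distribˡ-+-* 2 h h)))))
      h≤ : h ≤ 2 ^ h
      h≤ = <⇒≤ (n<2^n h)
      l≤ : 2 ^ l ≤ 2 ^ h
      l≤ = ^-monoʳ-≤ 2 (<⇒≤ l<h)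
      W≤ : W ≤ 2 ^ (3 * h)
      W≤ = begin
        h * h + h          ≤⟨ +-monoʳ-≤ (h * h) (m≤m*n h h) ⟩
        h * h + h * h      ≤⟨ +-mono-≤ (*-mono-≤ h≤ h≤) (*-mono-≤ h≤ h≤) ⟩
        2 ^ h * 2 ^ h + 2 ^ h * 2 ^ h ≡⟨ lem₁ (2 ^ h) ⟩
        2 ^ 1 * (2 ^ h * 2 ^ h)   ≤⟨ *-monoˡ-≤ (2 ^ h * 2 ^ h) (^-monoʳ-≤ 2 (>-nonZero⁻¹ h)) ⟩
        2 ^ h * (2 ^ h * 2 ^ h)   ≡⟨ cong (2 ^ h *_) (sym (^-distribˡ-+-* 2 h h)) ⟩
        2 ^ h * 2 ^ (h + h)       ≡⟨ sym (^-distribˡ-+-* 2 h (h + h)) ⟩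
        2 ^ (h + (h + h))         ≡⟨ cong (2 ^_) (lem₂ h) ⟩
        2 ^ (3 * h)               ∎
        where
        lem₁ : ∀ x → x * x + x * x ≡ 2 * 1 * (x * x)
        lem₁ = solve-∀
        lem₂ : ∀ h → h + (h + h) ≡ 3 * h
        lem₂ = solve-∀
      64g≤ : 64 * g ≤ 2 ^ (15 * h)
      64g≤ = begin
        64 * (256 * h)            ≡⟨ sym (*-assoc 64 256 h) ⟩
        2 ^ 14 * h                ≤⟨ *-mono-≤ (^-monoʳ-≤ 2 (m≤m*n 14 h)) h≤ ⟩
        2 ^ (14 * h) * 2 ^ h      ≡⟨ sym (^-distribˡ-+-* 2 (14 * h) h) ⟩
        2 ^ (14 * h + h)          ≡⟨ cong (2 ^_) (+-comm (14 * h) h) ⟩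
        2 ^ (15 * h)              ∎

    rare : ∀ l → l < h → 2 ^ W * sumW n (sparse (K (suc l)) (A (suc l)) m) ≤ 2 ^ n
    rare l l<h = sparse-rare (K (suc l)) (A (suc l)) (2 ^ (8 * g)) W m
      (^-monoʳ-≤ 2 (>-nonZero⁻¹ (8 * g) {{m*n≢0 8 g {{_}} {{m*n≢0 256 h}}}}))
      (subst₂ (λ k a → 2 ^ k ≤ 2 ^ (8 * g) * cnt k a) (sym (K≡ l)) (sym (A≡ l)) (cnt-dense (2 ^ l) {{m^n≢0 2 l}} g))
      ≤-refl (mK≤n l l<h)

    K≤n : K h ≤ n
    K≤n = ≤-trans (lower h) (mK≤n (pred h) (≤-reflexive (suc-pred h)))
      where
      m≢0 : NonZero m
      m≢0 = m*n≢0 W _ {{>-nonZero (≤-trans (>-nonZero⁻¹ h) (m≤n+m h (h * h)))}} {{m^n≢0 2 (8 * g)}}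
      lower : ∀ h .{{_ : NonZero h}} → K h ≤ m * K (suc (pred h))
      lower (suc l) = m≤n*m (K (suc l)) m {{m≢0}}

    -- There are `h` scales with a gain of `2 ^ h` each. The rich words and the words with many
    -- light windows contribute at most `2 ^ n` each, whence the factor 2.
    h²-P-upper : 2 ^ (h * h) * P n ≤ 2 * 2 ^ n
    h²-P-upper = *-cancelʳ-≤ _ _ (C h) {{C≢0 h}} (begin
      X * P n * C h
        ≡⟨ *-assoc X (P n) (C h) ⟩
      X * (P n * C h)
        ≤⟨ *-monoʳ-≤ X (P-bound h m n K≤n mK≤n) ⟩
      X * (sumW (K h) (T h) * 2 ^ (n ∸ K h) + C h * Σs)
        ≡⟨ lem₁ X (sumW (K h) (T h)) (2 ^ (n ∸ K h)) (C h) Σs ⟩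
      X * sumW (K h) (T h) * 2 ^ (n ∸ K h) + C h * (X * Σs)
        ≤⟨ +-mono-≤ (*-monoˡ-≤ (2 ^ (n ∸ K h)) (sumW-T h h (λ l _ → gain l))) (*-monoʳ-≤ (C h) XΣs≤) ⟩
      2 ^ K h * C h * 2 ^ (n ∸ K h) + C h * 2 ^ n
        ≡⟨ cong (_+ C h * 2 ^ n) (trans (lem₂ (2 ^ K h) (C h) _)
             (cong (C h *_) (trans (sym (^-distribˡ-+-* 2 (K h) _)) (cong (2 ^_) (m+[n∸m]≡n K≤n))))) ⟩
      C h * 2 ^ n + C h * 2 ^ n
        ≡⟨ lem₃ (C h) (2 ^ n) ⟩
      2 * 2 ^ n * C h ∎)
      where
      open ≤-Reasoning
      X Σs : ℕ
      X = 2 ^ (h * h)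
      Σs = sumN h (λ l → sumW n (sparse (K (suc l)) (A (suc l)) m))
      lem₁ : ∀ x z r c s → x * (z * r + c * s) ≡ x * z * r + c * (x * s)
      lem₁ = solve-∀
      lem₂ : ∀ k c r → k * c * r ≡ c * (k * r)
      lem₂ = solve-∀
      lem₃ : ∀ c n → c * n + c * n ≡ 2 * n * c
      lem₃ = solve-∀
      XΣs≤ : X * Σs ≤ 2 ^ n
      XΣs≤ = *-cancelˡ-≤ (2 ^ h) {{m^n≢0 2 h}} (begin
        2 ^ h * (X * Σs)
          ≡⟨ trans (sym (*-assoc (2 ^ h) X Σs))
               (cong (_* Σs) (trans (sym (^-distribˡ-+-* 2 h (h * h))) (cong (2 ^_) (+-comm h (h * h))))) ⟩
        2 ^ W * Σs
          ≡⟨ sym (sumN-*ˡ h (2 ^ W) _) ⟩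
        sumN h (λ l → 2 ^ W * sumW n (sparse (K (suc l)) (A (suc l)) m))
          ≤⟨ sumN-≤ h (2 ^ n) rare ⟩
        h * 2 ^ n
          ≤⟨ *-monoˡ-≤ (2 ^ n) (<⇒≤ (n<2^n h)) ⟩
        2 ^ h * 2 ^ n ∎)

P-upper : Σ ℕ λ b → 0 < b × (∀ h .{{_ : NonZero h}} n → 2 ^ (b * h) ≤ n → 2 ^ (h * h) * P n ≤ 2 * 2 ^ n)
P-upper = 2068 , s≤s z≤n , λ h n big → Scales.h²-P-upper h big

-- Squaring the hypothesis leaves a spare factor `2 ^ (h * h)`, at least 4, which absorbs the
-- squared 2; the power `c * c` then turns `h * h` into the square of the logarithm.
P-upper-square : ∀ c h n → 2 ≤ h * h → ⌊log₂ n ⌋ ≤ c * h → 2 ^ (h * h) * P n ≤ 2 * 2 ^ n →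
                 P n ^ (2 * (c * c)) * 2 ^ (1 * (⌊log₂ n ⌋ * ⌊log₂ n ⌋)) ≤ 2 ^ (2 * (c * c) * n)
P-upper-square c h n 2≤hh L≤ch XP≤ = begin
  P n ^ (2 * (c * c)) * 2 ^ (1 * (L * L))
    ≤⟨ *-monoʳ-≤ (P n ^ (2 * (c * c))) (^-monoʳ-≤ 2 (≤-trans (≤-reflexive (*-identityˡ (L * L)))
         (≤-trans (*-mono-≤ L≤ch L≤ch) (≤-reflexive (lem₁ c h))))) ⟩
  P n ^ (2 * (c * c)) * 2 ^ (h * h * (c * c))
    ≡⟨ cong₂ _*_ (sym (^-*-assoc (P n) 2 (c * c))) (sym (^-*-assoc 2 (h * h) (c * c))) ⟩
  (P n ^ 2) ^ (c * c) * (2 ^ (h * h)) ^ (c * c)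
    ≡⟨ sym ([x*y]^n (P n ^ 2) (2 ^ (h * h)) (c * c)) ⟩
  (P n ^ 2 * 2 ^ (h * h)) ^ (c * c)
    ≤⟨ ^-monoˡ-≤ (c * c) squared ⟩
  (2 ^ n * 2 ^ n) ^ (c * c)
    ≡⟨ trans (cong (_^ (c * c)) (sym (^-distribˡ-+-* 2 n n))) (^-*-assoc 2 (n + n) (c * c)) ⟩
  2 ^ ((n + n) * (c * c))
    ≡⟨ cong (2 ^_) (lem₂ n (c * c)) ⟩
  2 ^ (2 * (c * c) * n) ∎
  where
  open ≤-Reasoning
  L : ℕ
  L = ⌊log₂ n ⌋
  lem₁ : ∀ c h → c * h * (c * h) ≡ h * h * (c * c)
  lem₁ = solve-∀
  lem₂ : ∀ n s → (n + n) * s ≡ 2 * s * n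
  lem₂ = solve-∀
  X : ℕ
  X = 2 ^ (h * h)
  4≤X : 4 ≤ X
  4≤X = ^-monoʳ-≤ 2 2≤hh
  squared : P n ^ 2 * X ≤ 2 ^ n * 2 ^ n
  squared = *-cancelʳ-≤ _ _ 4 (begin
    P n ^ 2 * X * 4                 ≤⟨ *-monoʳ-≤ (P n ^ 2 * X) 4≤X ⟩
    P n ^ 2 * X * X                 ≡⟨ lem₃ (P n) X ⟩
    X * P n * (X * P n)             ≤⟨ *-mono-≤ XP≤ XP≤ ⟩
    2 * 2 ^ n * (2 * 2 ^ n)         ≡⟨ lem₄ (2 ^ n) ⟩
    2 ^ n * 2 ^ n * 4               ∎)
    where
    lem₃ : ∀ p x → p * (p * 1) * x * x ≡ x * p * (x * p)
    lem₃ = solve-∀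
    lem₄ : ∀ y → 2 * y * (2 * y) ≡ y * y * 4
    lem₄ = solve-∀

-- Lower bound

-- The number of `i < I` with `K * 4 ^ i ≤ t`, a capped base 4 logarithm of `t / K`; `I` is the
-- recursion bound.
level : ℕ → ℕ → ℕ → ℕ
level zero    K t = 0
level (suc I) K t with K ≤? t
... | yes _ = suc (level I (K * 4) t)
... | no  _ = 0

level-≤ : ∀ I K l {t} → t < K * 4 ^ l → level I K t ≤ l
level-≤ zero    K l       t< = z≤n
level-≤ (suc I) K l   {t} t< with K ≤? t
level-≤ (suc I) K l       t< | no _ = z≤n
level-≤ (suc I) K zero    {t} t< | yes K≤t = contradiction K≤t (<⇒≱ (subst (t <_) (*-identityʳ K) t<))
level-≤ (suc I) K (suc l) {t} t< | yes _ = s≤s (level-≤ I (K * 4) l (subst (t <_) (sym (*-assoc K 4 (4 ^ l))) t<))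

level-≥ : ∀ I K l {t} → l < I → K * 4 ^ l ≤ t → suc l ≤ level I K t
level-≥ (suc I) K l   {t} (s≤s l≤I) ≤t with K ≤? t
level-≥ (suc I) K l       (s≤s l≤I) ≤t | no K≰t = contradiction (≤-trans (m≤m*n K (4 ^ l) {{m^n≢0 4 l}}) ≤t) K≰t
level-≥ (suc I) K zero    (s≤s l≤I) ≤t | yes _  = s≤s z≤n
level-≥ (suc I) K (suc l) {t} (s≤s l<I) ≤t | yes _ =
  s≤s (level-≥ I (K * 4) l l<I (subst (_≤ t) (sym (*-assoc K 4 (4 ^ l))) ≤t))

level-mono : ∀ I K {s t} → s ≤ t → level I K s ≤ level I K t
level-mono zero    K s≤t = z≤n
level-mono (suc I) K {s} {t} s≤t with K ≤? s | K ≤? t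
... | no  _   | _       = z≤n
... | yes _   | yes _   = s≤s (level-mono I (K * 4) s≤t)
... | yes K≤s | no  K≰t = contradiction (≤-trans K≤s s≤t) K≰t

find-scale : ∀ I K {k} → K ≤ k → k < K * 4 ^ I → Σ ℕ λ l → l < I × K * 4 ^ l ≤ k × k < K * 4 ^ suc l
find-scale zero    K     K≤k k< = contradiction K≤k (<⇒≱ (subst (_ <_) (*-identityʳ K) k<))
find-scale (suc I) K {k} K≤k k< with K * 4 ≤? k
... | no  4K≰k = 0 , s≤s z≤n , subst (_≤ k) (sym (*-identityʳ K)) K≤k , ≰⇒> 4K≰k
... | yes 4K≤k with find-scale I (K * 4) 4K≤k (subst (k <_) (sym (*-assoc K 4 (4 ^ I))) k<)
...   | l , l<I , lo , hi = suc l , s≤s l<I , subst (_≤ k) (*-assoc K 4 (4 ^ l)) lo , subst (k <_) (*-assoc K 4 (4 ^ suc l)) hi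

-- Chernoff estimate for a prefix against a later window.

-- With `M = suc N` and `M′ = suc N′` the factors are `(2q + 1) M - 1` and `(2q + 1) M′ + 1`. Their
-- product is smaller the more the bias `1/M` in the prefix exceeds the bias `1/M′` in the window.
tilt-pair : ∀ q N N′ → N ≤ N′ →
  (N * suc q + (2 + N) * q) * (N′ * q + (2 + N′) * suc q) + (2 * q + 1) * (N′ ∸ N) + 1
  ≡ suc N * suc N′ * (4 * (q * suc q) + 1)
tilt-pair q N N′ N≤N′ with m≤n⇒∃[o]m+o≡n N≤N′
... | e , refl = trans (cong (λ d → (N * suc q + (2 + N) * q) * ((N + e) * q + (2 + (N + e)) * suc q) + (2 * q + 1) * d + 1)
                             (m+n∸m≡n N e)) (lem q N e)
  where
  lem : ∀ q N e → (N * suc q + (2 + N) * q) * ((N + e) * q + (2 + (N + e)) * suc q) + (2 * q + 1) * e + 1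
                  ≡ suc N * suc (N + e) * (4 * (q * suc q) + 1)
  lem = solve-∀

-- From `M ≤ u` and `M′ ≤ 2 (M′ - M)` the gain `2q (M′ - M)` is at least `8 M M′`; one of the eight
-- is spent on the 1 in `(2q + 1)² = 4q(q + 1) + 1`.
tilt-pair-far : ∀ u N N′ → suc N ≤ u → 2 * u ≤ suc N′ → let q = 8 * u in
  (N * suc q + (2 + N) * q) * (N′ * q + (2 + N′) * suc q) + 7 * (suc N * suc N′)
  ≤ suc N * suc N′ * (4 * (q * suc q))
tilt-pair-far u N N′ M≤u 2u≤M′ = +-cancelʳ-≤ (suc N * suc N′) _ _ (begin
  X + 7 * (suc N * suc N′) + suc N * suc N′     ≡⟨ lem₁ X (suc N * suc N′) ⟩
  X + 8 * (suc N * suc N′)                      ≤⟨ +-monoʳ-≤ X gap ⟩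
  X + (2 * q + 1) * (N′ ∸ N)                    ≤⟨ m≤m+n _ 1 ⟩
  X + (2 * q + 1) * (N′ ∸ N) + 1                ≡⟨ tilt-pair q N N′ N≤N′ ⟩
  suc N * suc N′ * (4 * (q * suc q) + 1)        ≡⟨ lem₂ (suc N * suc N′) (4 * (q * suc q)) ⟩
  suc N * suc N′ * (4 * (q * suc q)) + suc N * suc N′ ∎)
  where
  open ≤-Reasoning
  q X : ℕ
  q = 8 * u
  X = (N * suc q + (2 + N) * q) * (N′ * q + (2 + N′) * suc q)
  lem₁ : ∀ x m → x + 7 * m + m ≡ x + 8 * m
  lem₁ = solve-∀
  lem₂ : ∀ m q → m * (q + 1) ≡ m * q + m
  lem₂ = solve-∀
  2M≤M′ : suc N + suc N ≤ suc N′
  2M≤M′ = ≤-trans (+-mono-≤ M≤u M≤u) (≤-trans (≤-reflexive (cong (u +_) (sym (+-identityʳ u)))) 2u≤M′)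
  N≤N′ : N ≤ N′
  N≤N′ = s≤s⁻¹ (≤-trans (m≤m+n (suc N) (suc N)) 2M≤M′)
  M′≤2gap : suc N′ ≤ 2 * (N′ ∸ N)
  M′≤2gap = +-cancelʳ-≤ (suc N + suc N) _ _ (begin
    suc N′ + (suc N + suc N)                  ≤⟨ +-monoʳ-≤ (suc N′) 2M≤M′ ⟩
    suc N′ + suc N′                           ≡⟨ cong (λ x → suc x + suc x) (sym (m∸n+n≡m N≤N′)) ⟩
    suc (N′ ∸ N + N) + suc (N′ ∸ N + N)       ≡⟨ lem (N′ ∸ N) N ⟩
    2 * (N′ ∸ N) + (suc N + suc N)            ∎)
    where
    lem : ∀ d n → suc (d + n) + suc (d + n) ≡ 2 * d + (suc n + suc n)
    lem = solve-∀
  gap : 8 * (suc N * suc N′) ≤ (2 * q + 1) * (N′ ∸ N)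
  gap = begin
    8 * (suc N * suc N′)                ≤⟨ *-monoʳ-≤ 8 (*-mono-≤ M≤u M′≤2gap) ⟩
    8 * (u * (2 * (N′ ∸ N)))            ≡⟨ lem u (N′ ∸ N) ⟩
    2 * q * (N′ ∸ N)                    ≤⟨ *-monoˡ-≤ (N′ ∸ N) (m≤m+n (2 * q) 1) ⟩
    (2 * q + 1) * (N′ ∸ N)              ∎
    where
    lem : ∀ u d → 8 * (u * (2 * d)) ≡ 2 * (8 * u) * d
    lem = solve-∀

-- Relative to `Q = suc x`, a near factor is at most `1 - 7/Q ≤ (1 - 1/Q)^7`, and a far one at most
-- `1 + 1/Q ≤ (1 - 1/Q)^-1`. As `e ≤ 3 * k₁`, at least `4 * k₁` factors `1 - 1/Q` remain, enough for
-- `2 ^ Γ`.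
tilt-product : ∀ x k₁ e Γ (F G : ℕ → ℕ) → 6 ≤ x → e ≤ 3 * k₁ → Γ * x ≤ 4 * k₁ →
  (∀ t → t < k₁ → F t + 7 * G t ≤ G t * suc x) →
  (∀ t → t < k₁ + e → F t ≤ G t * suc (suc x)) →
  2 ^ Γ * prod (k₁ + e) F ≤ prod (k₁ + e) G * suc x ^ (k₁ + e)
tilt-product x k₁ e Γ F G 6≤x e≤ Γx≤ near far = *-cancelʳ-≤ _ _ (Q ^ (6 * k₁) * x ^ e) {{nz}} (begin
  2 ^ Γ * prod (k₁ + e) F * (Q ^ (6 * k₁) * x ^ e)
    ≡⟨ cong (λ p → 2 ^ Γ * p * (Q ^ (6 * k₁) * x ^ e)) (prod-+ k₁ e F) ⟩
  2 ^ Γ * (F₁ * F₂) * (Q ^ (6 * k₁) * x ^ e)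
    ≡⟨ lem₁ (2 ^ Γ) F₁ F₂ _ _ ⟩
  2 ^ Γ * ((F₁ * Q ^ (6 * k₁)) * (F₂ * x ^ e))
    ≤⟨ *-monoʳ-≤ (2 ^ Γ) (*-mono-≤ first second) ⟩
  2 ^ Γ * ((G₁ * x ^ (7 * k₁)) * (G₂ * (Q * Q) ^ e))
    ≡⟨ cong₂ (λ a b → 2 ^ Γ * ((G₁ * a) * (G₂ * b))) (trans (cong (x ^_) (sym e+f)) (^-distribˡ-+-* x e f)) ([x*y]^n Q Q e) ⟩
  2 ^ Γ * ((G₁ * (x ^ e * x ^ f)) * (G₂ * (Q ^ e * Q ^ e)))
    ≡⟨ lem₂ (2 ^ Γ) G₁ G₂ (x ^ e) (x ^ f) (Q ^ e) ⟩
  (G₁ * G₂ * Q ^ e) * (x ^ e * (Q ^ e * (2 ^ Γ * x ^ f)))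
    ≤⟨ *-monoʳ-≤ (G₁ * G₂ * Q ^ e) (*-monoʳ-≤ (x ^ e) (*-monoʳ-≤ (Q ^ e) (growth x {{x≢0}} Γ (≤-trans Γx≤ 4k₁≤f)))) ⟩
  (G₁ * G₂ * Q ^ e) * (x ^ e * (Q ^ e * Q ^ f))
    ≡⟨ cong (λ a → (G₁ * G₂ * Q ^ e) * (x ^ e * a)) (trans (sym (^-distribˡ-+-* Q e f)) (trans (cong (Q ^_) e+f) (^-distribˡ-+-* Q k₁ (6 * k₁)))) ⟩
  (G₁ * G₂ * Q ^ e) * (x ^ e * (Q ^ k₁ * Q ^ (6 * k₁)))
    ≡⟨ lem₃ (G₁ * G₂) (Q ^ e) (x ^ e) (Q ^ k₁) _ ⟩
  G₁ * G₂ * (Q ^ k₁ * Q ^ e) * (Q ^ (6 * k₁) * x ^ e)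
    ≡⟨ cong₂ (λ a b → a * b * (Q ^ (6 * k₁) * x ^ e)) (sym (prod-+ k₁ e G)) (sym (^-distribˡ-+-* Q k₁ e)) ⟩
  prod (k₁ + e) G * Q ^ (k₁ + e) * (Q ^ (6 * k₁) * x ^ e) ∎)
  where
  open ≤-Reasoning
  Q F₁ F₂ G₁ G₂ f : ℕ
  Q = suc x
  F₁ = prod k₁ F
  F₂ = prod e (F ∘ (k₁ +_))
  G₁ = prod k₁ G
  G₂ = prod e (G ∘ (k₁ +_))
  e≤7k₁ : e ≤ 7 * k₁
  e≤7k₁ = ≤-trans e≤ (*-monoˡ-≤ k₁ (≤ᵇ⇒≤ 3 7 _))
  f = 7 * k₁ ∸ e
  e+f : e + f ≡ 7 * k₁
  e+f = m+[n∸m]≡n e≤7k₁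
  4k₁≤f : 4 * k₁ ≤ f
  4k₁≤f = +-cancelˡ-≤ e _ _ (begin
    e + 4 * k₁            ≤⟨ +-monoˡ-≤ (4 * k₁) e≤ ⟩
    3 * k₁ + 4 * k₁       ≡⟨ sym (*-distribʳ-+ k₁ 3 4) ⟩
    7 * k₁                ≡⟨ sym e+f ⟩
    e + f                 ∎)
  x≢0 : NonZero x
  x≢0 = >-nonZero (≤-trans (s≤s z≤n) 6≤x)
  nz : NonZero (Q ^ (6 * k₁) * x ^ e)
  nz = m*n≢0 _ _ {{m^n≢0 Q (6 * k₁)}} {{m^n≢0 x e {{x≢0}}}}
  lem₁ : ∀ g a b c d → g * (a * b) * (c * d) ≡ g * ((a * c) * (b * d))
  lem₁ = solve-∀
  lem₂ : ∀ g a b c d h → g * ((a * (c * d)) * (b * (h * h))) ≡ (a * b * h) * (c * (h * (g * d)))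
  lem₂ = solve-∀
  lem₃ : ∀ a b c d e → (a * b) * (c * (d * e)) ≡ a * (d * b) * (e * c)
  lem₃ = solve-∀
  first : F₁ * Q ^ (6 * k₁) ≤ G₁ * x ^ (7 * k₁)
  first = begin
    F₁ * Q ^ (6 * k₁)                  ≡⟨ cong (F₁ *_) (trans (sym (^-*-assoc Q 6 k₁)) (sym (prod-const k₁ (Q ^ 6)))) ⟩
    F₁ * prod k₁ (λ _ → Q ^ 6)         ≡⟨ sym (prod-* k₁ F _) ⟩
    prod k₁ (λ t → F t * Q ^ 6)        ≤⟨ prod-mono k₁ pointwise ⟩
    prod k₁ (λ t → G t * x ^ 7)        ≡⟨ prod-* k₁ G _ ⟩
    G₁ * prod k₁ (λ _ → x ^ 7)         ≡⟨ cong (G₁ *_) (trans (prod-const k₁ (x ^ 7)) (^-*-assoc x 7 k₁)) ⟩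
    G₁ * x ^ (7 * k₁)                  ∎
    where
    d : ℕ
    d = x ∸ 6
    6+d : 6 + d ≡ x
    6+d = m+[n∸m]≡n 6≤x
    F≤ : ∀ t → t < k₁ → F t ≤ G t * d
    F≤ t t< = +-cancelʳ-≤ (7 * G t) _ _ (≤-trans (near t t<)
      (≤-reflexive (trans (cong (λ y → G t * suc y) (sym 6+d)) (lem (G t) d))))
      where
      lem : ∀ g d → g * suc (6 + d) ≡ g * d + 7 * g
      lem = solve-∀
    pointwise : ∀ t → t < k₁ → F t * Q ^ 6 ≤ G t * x ^ 7
    pointwise t t< = begin
      F t * Q ^ 6           ≤⟨ *-monoˡ-≤ (Q ^ 6) (F≤ t t<) ⟩
      G t * d * Q ^ 6       ≡⟨ trans (*-assoc (G t) d _) (cong (G t *_) (*-comm d _)) ⟩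
      G t * (Q ^ 6 * d)     ≤⟨ *-monoʳ-≤ (G t) (reverse-bernoulli x 6 d 6+d) ⟩
      G t * (x ^ 6 * x)     ≡⟨ cong (G t *_) (*-comm (x ^ 6) x) ⟩
      G t * x ^ 7           ∎
  second : F₂ * x ^ e ≤ G₂ * (Q * Q) ^ e
  second = begin
    F₂ * x ^ e                               ≡⟨ cong (F₂ *_) (sym (prod-const e x)) ⟩
    F₂ * prod e (λ _ → x)                    ≡⟨ sym (prod-* e (F ∘ (k₁ +_)) _) ⟩
    prod e (λ t → F (k₁ + t) * x)            ≤⟨ prod-mono e pointwise ⟩
    prod e (λ t → G (k₁ + t) * (Q * Q))      ≡⟨ prod-* e (G ∘ (k₁ +_)) _ ⟩
    G₂ * prod e (λ _ → Q * Q)                ≡⟨ cong (G₂ *_) (prod-const e (Q * Q)) ⟩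
    G₂ * (Q * Q) ^ e                         ∎
    where
    lem : ∀ x → suc (suc x) * x + 1 ≡ suc x * suc x
    lem = solve-∀
    pointwise : ∀ t → t < e → F (k₁ + t) * x ≤ G (k₁ + t) * (Q * Q)
    pointwise t t<e = begin
      F (k₁ + t) * x                   ≤⟨ *-monoˡ-≤ x (far (k₁ + t) (+-monoʳ-< k₁ t<e)) ⟩
      G (k₁ + t) * suc Q * x           ≡⟨ *-assoc (G (k₁ + t)) (suc Q) x ⟩
      G (k₁ + t) * (suc Q * x)         ≤⟨ *-monoʳ-≤ (G (k₁ + t)) (≤-trans (m≤m+n _ 1) (≤-reflexive (lem x))) ⟩
      G (k₁ + t) * (Q * Q)             ∎

-- The right side is the left side times `((q + 1)/q)^(ones v - ones u)`. This is the lower bound on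
-- the tilt that Markov's inequality needs.
tilt-balance : ∀ q {k} u v → length u ≡ k → length v ≡ k → ones u < ones v →
  (q * suc q) ^ k ≤ wt (λ _ → tilt q (suc q)) u * wt (λ _ → tilt (suc q) q) v
tilt-balance q {k} u v |u| |v| u<v with zeros u | zeros v | m≤n⇒∃[o]m+o≡n (<⇒≤ u<v)
... | y , u+y | z , v+z | e , u+e
  rewrite wt-tilt q (suc q) u y u+y | wt-tilt (suc q) q v z v+z = begin
  (q * suc q) ^ k
    ≡⟨ [x*y]^n q (suc q) k ⟩
  q ^ k * suc q ^ k
    ≡⟨ cong₂ _*_ (trans (cong (q ^_) k≡) (trans (^-distribˡ-+-* q (o + z) e) (cong (_* q ^ e) (^-distribˡ-+-* q o z))))
                 (trans (cong (suc q ^_) (sym (trans u+y |u|))) (^-distribˡ-+-* (suc q) o y)) ⟩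
  q ^ o * q ^ z * q ^ e * (suc q ^ o * suc q ^ y)
    ≤⟨ *-monoˡ-≤ _ (*-monoʳ-≤ (q ^ o * q ^ z) (^-monoˡ-≤ e (n≤1+n q))) ⟩
  q ^ o * q ^ z * suc q ^ e * (suc q ^ o * suc q ^ y)
    ≡⟨ lem (q ^ o) (q ^ z) (suc q ^ e) (suc q ^ o) (suc q ^ y) ⟩
  q ^ o * suc q ^ y * (suc q ^ o * suc q ^ e * q ^ z)
    ≡⟨ cong (λ x → q ^ o * suc q ^ y * (x * q ^ z)) (trans (sym (^-distribˡ-+-* (suc q) o e)) (cong (suc q ^_) u+e)) ⟩
  q ^ o * suc q ^ y * (suc q ^ ones v * q ^ z) ∎
  where
  open ≤-Reasoning
  o : ℕ
  o = ones u
  k≡ : k ≡ o + z + e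
  k≡ = trans (sym (trans v+z |v|)) (trans (cong (_+ z) (sym u+e)) (lem′ o e z))
    where
    lem′ : ∀ o e z → o + e + z ≡ o + z + e
    lem′ = solve-∀
  lem : ∀ a b c d f → a * b * c * (d * f) ≡ a * f * (d * c * b)
  lem = solve-∀

wt≡0 : ∀ φ u → (∀ t → t < length u → φ t false ≡ 0) → ones u < length u → wt φ u ≡ 0
wt≡0 φ (false ∷ u) φ≡0 _        = cong (_* wt (φ ∘ suc) u) (φ≡0 0 (s≤s z≤n))
wt≡0 φ (true  ∷ u) φ≡0 (s≤s u<) = trans (cong (φ 0 true *_) (wt≡0 (φ ∘ suc) u (λ t t< → φ≡0 (suc t) (s≤s t<)) u<))
                                        (*-zeroʳ (φ 0 true))

-- Violations of prefix normality by disjoint windows.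

-- The gap `c` separates the prefix from the window, so the two are independent under a product
-- measure.
Exceeds : ℕ → ℕ → List Bool → Set
Exceeds k c w = ones (take k w) < ones (take k (drop (k + c) w))

exceeds? : ∀ k c → Decidable (Exceeds k c)
exceeds? k c w = ones (take k w) <? ones (take k (drop (k + c) w))

-- For j < k, deleting the overlap of w[1,k] and w[j+1,j+k] leaves w[1,j] and w[k+1,k+j].
disjoint-prefixNormal : ∀ w → (∀ k c → k + (c + k) ≤ length w → ¬ Exceeds k c w) → PrefixNormal w
disjoint-prefixNormal w none k j j+k≤ with ≤-total k j
... | inj₁ k≤j with m≤n⇒∃[o]m+o≡n k≤j
...   | c , refl = ≮⇒≥ (none k c (subst (_≤ length w) (+-assoc k c k) j+k≤))
disjoint-prefixNormal w none k j j+k≤ | inj₂ j≤k with m≤n⇒∃[o]m+o≡n j≤k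
...   | c , refl = +-cancelˡ-≤ (ones (take j w)) _ _ (begin
    ones (take j w) + ones (take (j + c) (drop j w))
      ≡⟨ sym (ones-++take j (j + c) w) ⟩
    ones (take (j + (j + c)) w)
      ≡⟨ cong (λ m → ones (take m w)) (+-comm j (j + c)) ⟩
    ones (take (j + c + j) w)
      ≡⟨ ones-++take (j + c) j w ⟩
    ones (take (j + c) w) + ones (take j (drop (j + c) w))
      ≤⟨ +-monoʳ-≤ (ones (take (j + c) w)) (≮⇒≥ (none j c
           (subst (_≤ length w) (cong (j +_) (+-comm j c)) j+k≤))) ⟩
    ones (take (j + c) w) + ones (take j w)
      ≡⟨ +-comm (ones (take (j + c) w)) _ ⟩
    ones (take j w) + ones (take (j + c) w) ∎)
  where open ≤-Reasoning

violation : ℕ → ℕ → ℕ → List Bool → ℕ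
violation n k c w = ⟦ (k + (c + k) ≤? n) ×-dec exceeds? k c w ⟧

violations : ℕ → List Bool → ℕ
violations n w = sumN (suc n) (λ k → sumN (suc n) (λ c → violation n k c w))

prefixNormal-or-violation : ∀ n w → length w ≡ n → 1 ≤ ⟦ prefixNormal? w ⟧ + violations n w
prefixNormal-or-violation n w |w| with prefixNormal? w
... | yes _  = s≤s z≤n
... | no ¬pn with violations n w in eq
...   | suc _ = s≤s z≤n
...   | zero  = contradiction (disjoint-prefixNormal w none) ¬pn
  where
  none : ∀ k c → k + (c + k) ≤ length w → ¬ Exceeds k c w
  none k c fits exceeds = contradiction (begin
      1                                              ≤⟨ one ⟩
      violation n k c w                              ≤⟨ term≤sumN (suc n) (λ c → violation n k c w) (s≤s c≤n) ⟩
      sumN (suc n) (λ c → violation n k c w)         ≤⟨ term≤sumN (suc n) (λ k → sumN (suc n) (λ c → violation n k c w)) (s≤s k≤n) ⟩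
      violations n w                                 ≡⟨ eq ⟩
      0                                              ∎) (λ ())
    where
    open ≤-Reasoning
    fits′ : k + (c + k) ≤ n
    fits′ = subst (k + (c + k) ≤_) |w| fits
    k≤n : k ≤ n
    k≤n = ≤-trans (m≤m+n k (c + k)) fits′
    c≤n : c ≤ n
    c≤n = ≤-trans (≤-trans (m≤m+n c k) (m≤n+m (c + k) k)) fits′
    one : 1 ≤ violation n k c w
    one with (k + (c + k) ≤? n) ×-dec exceeds? k c w
    ... | yes _ = ≤-refl
    ... | no ¬v = contradiction (fits′ , exceeds) ¬v

-- The biased random word.

module Measure (I Γ : ℕ) where

  -- Level 0, the first K positions, is forced to be 1; its length makes every single
  -- violation have probability at most 2^-Γ.
  K : ℕ
  K = 72 * Γ

  lev M N : ℕ → ℕ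
  lev   = level I K
  M t   = 2 ^ lev t
  N t   = pred (M t)

  sucN : ∀ t → suc (N t) ≡ M t
  sucN t = suc-pred (M t) {{m^n≢0 2 (lev t)}}

  N-mono : ∀ {s t} → s ≤ t → N s ≤ N t
  N-mono s≤t = pred-mono-≤ (^-monoʳ-≤ 2 (level-mono I K s≤t))

  -- At level i a letter is 1 with probability (1 + 2⁻ⁱ)/2.
  μ : ℕ → Bool → ℕ
  μ t true  = 2 + N t
  μ t false = N t

  total-μ : ∀ t → total μ t ≡ 2 * M t
  total-μ t = trans (lem (N t)) (cong (2 *_) (sucN t))
    where
    lem : ∀ n → n + (2 + n) ≡ 2 * suc n
    lem = solve-∀

  module _ (k c r : ℕ) where

    private
      n : ℕ
      n = k + (c + (k + r))

      μc μk μr : ℕ → Bool → ℕ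
      μc t = μ (k + t)
      μk t = μ (k + (c + t))
      μr t = μ (k + (c + (k + t)))

      win : List Bool → List Bool
      win w = take k (drop c (drop k w))

    -- A zero among the first `K` letters has weight 0, and a prefix of ones only cannot be
    -- exceeded.
    short-window : k ≤ K → sumW n (λ w → ⟦ exceeds? k c w ⟧ * wt μ w) ≡ 0
    short-window k≤K = trans (sumW-cong n zero-term) (sumW-0 n)
      where
      zero-term : ∀ w → length w ≡ n → ⟦ exceeds? k c w ⟧ * wt μ w ≡ 0
      zero-term w |w| with exceeds? k c w
      ... | no _  = refl
      ... | yes e = trans (+-identityʳ (wt μ w)) (trans (wt-split k μ w) (cong (_* wt (μ ∘ (k +_)) (drop k w))
              (wt≡0 μ (take k w) low few)))
        where
        |u| : length (take k w) ≡ k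
        |u| = length-take-≤ k w (subst (k ≤_) (sym |w|) (m≤m+n k _))
        low : ∀ t → t < length (take k w) → μ t false ≡ 0
        low t t< = cong (λ l → pred (2 ^ l)) (n≤0⇒n≡0 (level-≤ I K 0
          (<-≤-trans (subst (t <_) |u| t<) (≤-trans k≤K (≤-reflexive (sym (*-identityʳ K)))))))
        few : ones (take k w) < length (take k w)
        few = <-≤-trans e (≤-trans (ones≤length (take k (drop (k + c) w)))
                (≤-trans (≤-reflexive (length-take k (drop (k + c) w))) (≤-trans (m⊓n≤m k _) (≤-reflexive (sym |u|)))))

    module _ (q : ℕ) .{{_ : NonZero q}} where

      down up : ℕ → ℕ
      down s = N s * suc q + (2 + N s) * q
      up   s = N s * q + (2 + N s) * suc q

      private
        φ₁ φ₂ : ℕ → Bool → ℕ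
        φ₁ t b = μ t b * tilt q (suc q) b
        φ₂ t b = μk t b * tilt (suc q) q b

        G : List Bool → ℕ
        G w = wt φ₁ (take k w) * (wt μc (take c (drop k w)) * (wt φ₂ (win w) * wt μr (drop k (drop c (drop k w)))))

        R : ℕ
        R = q * suc q

      -- Chernoff's method: the indicator is bounded by a tilt that favours zeros in the prefix and
      -- ones in the window. `G` is a product over the prefix, the gap, the window and the rest, so
      -- its sum factorises.
      exceeds-tilt : ∀ w → length w ≡ n → R ^ k * (⟦ exceeds? k c w ⟧ * wt μ w) ≤ G w
      exceeds-tilt w |w| with exceeds? k c w
      ... | no _  = ≤-trans (≤-reflexive (*-zeroʳ (R ^ k))) z≤n
      ... | yes e = begin
        R ^ k * (wt μ w + 0)
          ≡⟨ cong (R ^ k *_) (trans (+-identityʳ (wt μ w)) split) ⟩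
        R ^ k * (a * (b * (d * f)))
          ≤⟨ *-monoˡ-≤ (a * (b * (d * f))) (tilt-balance q (take k w) (win w) |u| |v|
               (subst (λ x → ones (take k w) < ones (take k x)) (sym (drop-drop k c w)) e)) ⟩
        x * y * (a * (b * (d * f)))
          ≡⟨ lem x y a b d f ⟩
        a * x * (b * (d * y * f))
          ≡⟨ cong₂ (λ p s → p * (b * (s * f))) (sym (wt-* μ (λ _ → tilt q (suc q)) (take k w)))
                                              (sym (wt-* μk (λ _ → tilt (suc q) q) (win w))) ⟩
        G w ∎
        where
        open ≤-Reasoning
        a b d f x y : ℕ
        a = wt μ (take k w)
        b = wt μc (take c (drop k w))
        d = wt μk (win w)
        f = wt μr (drop k (drop c (drop k w)))
        x = wt (λ _ → tilt q (suc q)) (take k w)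
        y = wt (λ _ → tilt (suc q) q) (win w)
        lem : ∀ x y a b d f → x * y * (a * (b * (d * f))) ≡ a * x * (b * (d * y * f))
        lem = solve-∀
        split : wt μ w ≡ a * (b * (d * f))
        split = trans (wt-split k μ w) (cong (a *_) (trans (wt-split c μc (drop k w)) (cong (b *_) (wt-split k μk (drop c (drop k w))))))
        |u| : length (take k w) ≡ k
        |u| = length-take-≤ k w (subst (k ≤_) (sym |w|) (m≤m+n k _))
        |v| : length (win w) ≡ k
        |v| = length-take-≤ k _ (≤-trans (m≤m+n k r) (≤-reflexive (sym rest)))
          where
          rest : length (drop c (drop k w)) ≡ k + r
          rest = trans (length-drop c (drop k w)) (trans (cong (_∸ c) (trans (length-drop k w)
                   (trans (cong (_∸ k) |w|) (m+n∸m≡n k _)))) (m+n∸m≡n c _))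

      sumW-G : sumW n G ≡ prod k down * (prod c (total μc) * (prod k (λ t → up (k + (c + t))) * prod r (total μr)))
      sumW-G = begin
        sumW n G
          ≡⟨ sumW-take-drop k (c + (k + r)) (wt φ₁) _ ⟩
        sumW k (wt φ₁) * sumW (c + (k + r)) _
          ≡⟨ cong₂ _*_ (sumW-wt k φ₁)
                       (sumW-take-drop c (k + r) (wt μc) _) ⟩
        prod k down * (sumW c (wt μc) * sumW (k + r) _)
          ≡⟨ cong (prod k down *_) (cong₂ _*_ (sumW-wt c μc) (sumW-take-drop k r (wt φ₂) (wt μr))) ⟩
        prod k down * (prod c (total μc) * (sumW k (wt φ₂) * sumW r (wt μr)))
          ≡⟨ cong (λ z → prod k down * (prod c (total μc) * z)) (cong₂ _*_
               (sumW-wt k φ₂) (sumW-wt r μr)) ⟩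
        prod k down * (prod c (total μc) * (prod k (λ t → up (k + (c + t))) * prod r (total μr))) ∎
        where open ≡-Reasoning

      -- Letter `t` of the prefix is paired with letter `t` of the window, since only the product of
      -- the two tilted totals is small; the gap and the rest cancel.
      exceeds-bound : 2 ^ Γ * prod k (λ t → down t * up (k + (c + t)))
                        ≤ prod k (λ t → suc (N t) * suc (N (k + (c + t)))) * (4 * R) ^ k →
                      2 ^ Γ * sumW n (λ w → ⟦ exceeds? k c w ⟧ * wt μ w) ≤ prod n (total μ)
      exceeds-bound hyp = *-cancelˡ-≤ (R ^ k) {{m^n≢0 R k {{m*n≢0 q (suc q)}}}} (begin
        R ^ k * (2 ^ Γ * sumW n (λ w → ⟦ exceeds? k c w ⟧ * wt μ w))
          ≡⟨ lem₁ (R ^ k) (2 ^ Γ) _ ⟩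
        2 ^ Γ * (R ^ k * sumW n (λ w → ⟦ exceeds? k c w ⟧ * wt μ w))
          ≡⟨ cong (2 ^ Γ *_) (sym (sumW-*ˡ n (R ^ k) _)) ⟩
        2 ^ Γ * sumW n (λ w → R ^ k * (⟦ exceeds? k c w ⟧ * wt μ w))
          ≤⟨ *-monoʳ-≤ (2 ^ Γ) (sumW-mono n exceeds-tilt) ⟩
        2 ^ Γ * sumW n G
          ≡⟨ cong (2 ^ Γ *_) sumW-G ⟩
        2 ^ Γ * (prod k down * (C′ * (prod k (λ t → up (k + (c + t))) * R′)))
          ≡⟨ lem₂ (2 ^ Γ) (prod k down) C′ _ R′ ⟩
        2 ^ Γ * (prod k down * prod k (λ t → up (k + (c + t)))) * (C′ * R′)
          ≡⟨ cong (λ z → 2 ^ Γ * z * (C′ * R′)) (sym (prod-* k down _)) ⟩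
        2 ^ Γ * prod k (λ t → down t * up (k + (c + t))) * (C′ * R′)
          ≤⟨ *-monoˡ-≤ (C′ * R′) hyp ⟩
        prod k (λ t → suc (N t) * suc (N (k + (c + t)))) * (4 * R) ^ k * (C′ * R′)
          ≡⟨ cong (_* (C′ * R′)) (trans (cong₂ _*_ (prod-* k (suc ∘ N) _)
               (trans ([x*y]^n 4 R k) (cong (_* R ^ k) ([x*y]^n 2 2 k)))) (lem₃ _ _ (2 ^ k) (R ^ k))) ⟩
        R ^ k * ((2 ^ k * prod k (suc ∘ N)) * (2 ^ k * prod k (λ t → suc (N (k + (c + t)))))) * (C′ * R′)
          ≡⟨ cong (λ z → R ^ k * z * (C′ * R′)) (cong₂ _*_ (doubles (suc ∘ N)) (doubles (λ t → suc (N (k + (c + t)))))) ⟩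
        R ^ k * (prod k (λ t → 2 * suc (N t)) * prod k (λ t → 2 * suc (N (k + (c + t))))) * (C′ * R′)
          ≡⟨ cong (λ z → R ^ k * z * (C′ * R′)) (cong₂ _*_ (prod-cong k (λ t _ → lem₅ (N t))) (prod-cong k (λ t _ → lem₅ (N (k + (c + t)))))) ⟩
        R ^ k * (prod k (total μ) * prod k (total μk)) * (C′ * R′)
          ≡⟨ lem₄ (R ^ k) (prod k (total μ)) (prod k (total μk)) C′ R′ ⟩
        R ^ k * (prod k (total μ) * (C′ * (prod k (total μk) * R′)))
          ≡⟨ cong (R ^ k *_) (sym split) ⟩
        R ^ k * prod n (total μ) ∎)
        where
        open ≤-Reasoning
        C′ R′ : ℕ
        C′ = prod c (total μc)
        R′ = prod r (total μr)
        lem₁ : ∀ a b c → a * (b * c) ≡ b * (a * c)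
        lem₁ = solve-∀
        lem₂ : ∀ g p c u r → g * (p * (c * (u * r))) ≡ g * (p * u) * (c * r)
        lem₂ = solve-∀
        lem₃ : ∀ p u t r → p * u * (t * t * r) ≡ r * ((t * p) * (t * u))
        lem₃ = solve-∀
        lem₄ : ∀ a p u c r → a * (p * u) * (c * r) ≡ a * (p * (c * (u * r)))
        lem₄ = solve-∀
        lem₅ : ∀ n → 2 * suc n ≡ n + (2 + n)
        lem₅ = solve-∀
        doubles : ∀ f → 2 ^ k * prod k f ≡ prod k (λ t → 2 * f t)
        doubles f = trans (cong (_* prod k f) (sym (prod-const k 2))) (sym (prod-* k (λ _ → 2) f))
        split : prod n (total μ) ≡ prod k (total μ) * (C′ * (prod k (total μk) * R′))
        split = trans (prod-+ k (c + (k + r)) (total μ)) (cong (prod k (total μ) *_)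
          (trans (prod-+ c (k + r) (total μc)) (cong (C′ *_) (prod-+ k r (total μk)))))

    window-bound : n ≤ K * 4 ^ I → 2 ^ Γ * sumW n (λ w → ⟦ exceeds? k c w ⟧ * wt μ w) ≤ prod n (total μ)
    window-bound n≤ with k ≤? K
    ... | yes k≤K = ≤-trans (≤-reflexive (trans (cong (2 ^ Γ *_) (short-window k≤K)) (*-zeroʳ (2 ^ Γ)))) z≤n
    ... | no  k≰K with find-scale I K (<⇒≤ (≰⇒> k≰K)) k<
      where
      k<n : k < n
      k<n = m<m+n k (≤-trans (≤-trans (s≤s z≤n) (≰⇒> k≰K)) (≤-trans (m≤m+n k r) (m≤n+m (k + r) c)))
      k< : k < K * 4 ^ I
      k< = <-≤-trans k<n n≤
    ...   | l , l<I , lo , hi with m≤n⇒∃[o]m+o≡n lo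
    ...     | e , k₁+e = exceeds-bound q {{q≢0}} hyp
      where
      u q Q k₁ : ℕ
      u  = 2 ^ l
      -- The tilt is proportional to the bias `1/u` of this scale. With `q = κ u` a near letter
      -- gains κ - 1, while the far letters lose at most 3 per near letter, so this balance needs κ
      -- above 4; κ = 8 leaves 4.
      q  = 8 * u
      Q  = 4 * (q * suc q)
      k₁ = K * 4 ^ l
      u≢0 : NonZero u
      u≢0 = m^n≢0 2 l
      q≢0 : NonZero q
      q≢0 = m*n≢0 8 u {{_}} {{u≢0}}
      8≤q : 8 ≤ q
      8≤q = m≤m*n 8 u {{u≢0}}
      7≤Q : 7 ≤ Q
      7≤Q = ≤-trans (≤ᵇ⇒≤ 7 (4 * (8 * 1)) _) (*-monoʳ-≤ 4 (*-mono-≤ 8≤q (s≤s z≤n)))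
      sucQ : suc (pred Q) ≡ Q
      sucQ = suc-pred Q {{>-nonZero (≤-trans (s≤s z≤n) 7≤Q)}}
      x : ℕ
      x = pred Q
      6≤x : 6 ≤ x
      6≤x = pred-mono-≤ 7≤Q
      e≤ : e ≤ 3 * k₁
      e≤ = +-cancelˡ-≤ k₁ _ _ (begin
        k₁ + e             ≡⟨ k₁+e ⟩
        k                  ≤⟨ <⇒≤ hi ⟩
        K * (4 * 4 ^ l)    ≡⟨ lem K (4 ^ l) ⟩
        k₁ + 3 * k₁        ∎)
        where
        open ≤-Reasoning
        lem : ∀ K t → K * (4 * t) ≡ K * t + 3 * (K * t)
        lem = solve-∀
      Γx≤ : Γ * x ≤ 4 * k₁
      -- The 72 in `K` is `8 · 9`, from `q = 8u` and `suc q ≤ 9u`.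
      Γx≤ = begin
        Γ * x                                  ≤⟨ *-monoʳ-≤ Γ (pred[n]≤n {Q}) ⟩
        Γ * (4 * (q * suc q))                  ≤⟨ *-monoʳ-≤ Γ (*-monoʳ-≤ 4 (*-monoʳ-≤ q (+-monoˡ-≤ q (>-nonZero⁻¹ u {{u≢0}})))) ⟩
        Γ * (4 * (8 * u * (u + 8 * u)))        ≡⟨ lem Γ u ⟩
        4 * (72 * Γ * (u * u))                 ≡⟨ cong (λ z → 4 * (72 * Γ * z)) (sym ([x*y]^n 2 2 l)) ⟩
        4 * k₁                                 ∎
        where
        open ≤-Reasoning
        lem : ∀ g u → g * (4 * (8 * u * (u + 8 * u))) ≡ 4 * (72 * g * (u * u))
        lem = solve-∀
      F G : ℕ → ℕ
      F t = down q {{q≢0}} t * up q {{q≢0}} (k + (c + t))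
      G t = suc (N t) * suc (N (k + (c + t)))
      -- The first `k₁` letters have level at most `l`, while the whole window starts beyond
      -- `K * 4 ^ l` and has level at least `suc l`. For the other letters `far` has only
      -- monotonicity of the level.
      near : ∀ t → t < k₁ → F t + 7 * G t ≤ G t * suc x
      near t t<k₁ = subst (λ z → F t + 7 * G t ≤ G t * z) (sym sucQ) (tilt-pair-far u (N t) (N (k + (c + t)))
        (subst (_≤ u) (sym (sucN t)) (^-monoʳ-≤ 2 (level-≤ I K l t<k₁)))
        (subst (2 * u ≤_) (sym (sucN (k + (c + t)))) (^-monoʳ-≤ 2 (level-≥ I K l l<I (≤-trans lo (m≤m+n k (c + t)))))))
      far : ∀ t → t < k₁ + e → F t ≤ G t * suc (suc x)
      far t t< = ≤-trans (m≤m+n (F t) ((2 * q + 1) * (N (k + (c + t)) ∸ N t) + 1)) (≤-reflexive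
        (trans (sym (+-assoc (F t) _ 1)) (trans (tilt-pair q (N t) (N (k + (c + t))) (N-mono t≤))
          (cong (G t *_) (trans (+-comm Q 1) (cong suc (sym sucQ)))))))
        where
        t≤ : t ≤ k + (c + t)
        t≤ = ≤-trans (m≤n+m t c) (m≤n+m (c + t) k)
      hyp : 2 ^ Γ * prod k F ≤ prod k G * Q ^ k
      hyp = subst₂ (λ m z → 2 ^ Γ * prod m F ≤ prod m G * z ^ m) k₁+e sucQ
              (tilt-product x k₁ e Γ F G 6≤x e≤ Γx≤ near far)

-- Ratios prod n (1 + X) / prod n X increase with n.
prod-suc-shorten : ∀ m r X c → (∀ t → 0 < X t) → prod (m + r) (suc ∘ X) ≤ c * prod (m + r) X →
                   prod m (suc ∘ X) ≤ c * prod m X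
prod-suc-shorten m r X c X>0 le = *-cancelʳ-≤ _ _ (prod r (X ∘ (m +_))) {{prod≢0 r (λ t → X>0 (m + t))}} (begin
  prod m (suc ∘ X) * prod r (X ∘ (m +_))           ≤⟨ *-monoʳ-≤ (prod m (suc ∘ X)) (prod-mono r (λ t _ → n≤1+n _)) ⟩
  prod m (suc ∘ X) * prod r (suc ∘ X ∘ (m +_))     ≡⟨ sym (prod-+ m r (suc ∘ X)) ⟩
  prod (m + r) (suc ∘ X)                           ≤⟨ le ⟩
  c * prod (m + r) X                               ≡⟨ cong (c *_) (prod-+ m r X) ⟩
  c * (prod m X * prod r (X ∘ (m +_)))             ≡⟨ sym (*-assoc c _ _) ⟩
  c * prod m X * prod r (X ∘ (m +_))               ∎)
  where open ≤-Reasoning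

prod-suc-block : ∀ b z h X .{{_ : NonZero z}} y → (∀ t → z ≤ X t) → 2 * y ≤ z → b ≤ h * y →
                 prod b (suc ∘ X) ≤ 2 ^ h * prod b X
prod-suc-block b z h X y z≤X 2y≤z b≤hy = *-cancelʳ-≤ _ _ (z ^ b) {{m^n≢0 z b}} (begin
  prod b (suc ∘ X) * z ^ b               ≡⟨ cong (prod b (suc ∘ X) *_) (sym (prod-const b z)) ⟩
  prod b (suc ∘ X) * prod b (λ _ → z)    ≡⟨ sym (prod-* b (suc ∘ X) _) ⟩
  prod b (λ t → suc (X t) * z)           ≤⟨ prod-mono b (λ t _ → pointwise t) ⟩
  prod b (λ t → X t * suc z)             ≡⟨ trans (prod-* b X _) (cong (prod b X *_) (prod-const b (suc z))) ⟩
  prod b X * suc z ^ b                   ≤⟨ *-monoʳ-≤ (prod b X) (slow-growth z y h 2y≤z b≤hy) ⟩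
  prod b X * (2 ^ h * z ^ b)             ≡⟨ lem (prod b X) (2 ^ h) (z ^ b) ⟩
  2 ^ h * prod b X * z ^ b               ∎)
  where
  open ≤-Reasoning
  lem : ∀ x y z → x * (y * z) ≡ y * x * z
  lem = solve-∀
  pointwise : ∀ t → suc (X t) * z ≤ X t * suc z
  pointwise t = ≤-trans (+-monoˡ-≤ (X t * z) (z≤X t)) (≤-reflexive (sym (*-suc (X t) z)))

-- Union bound and second moment.

module LowerBound (I Γ n : ℕ) (n≤ : n ≤ 72 * Γ * 4 ^ I) (union : 2 * (suc n * suc n) ≤ 2 ^ Γ) where

  open Measure I Γ

  D S : ℕ
  D = prod n (total μ)
  S = sumW n (λ w → ⟦ prefixNormal? w ⟧ * wt μ w)

  violation-bound : ∀ k c → 2 ^ Γ * sumW n (λ w → violation n k c w * wt μ w) ≤ D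
  violation-bound k c with k + (c + k) ≤? n
  ... | no _  = ≤-trans (≤-reflexive (trans (cong (2 ^ Γ *_) (sumW-0 n)) (*-zeroʳ (2 ^ Γ)))) z≤n
  ... | yes fits with m≤n⇒∃[o]m+o≡n fits
  ...   | r , eq = ≤-trans (*-monoʳ-≤ (2 ^ Γ) (sumW-mono n λ w _ → *-monoˡ-≤ (wt μ w) (drop-yes w))) at-n
    where
    shape : k + (c + (k + r)) ≡ n
    shape = trans (lem k c r) eq
      where
      lem : ∀ k c r → k + (c + (k + r)) ≡ k + (c + k) + r
      lem = solve-∀
    at-n : 2 ^ Γ * sumW n (λ w → ⟦ exceeds? k c w ⟧ * wt μ w) ≤ D
    at-n = subst (λ m → m ≤ 72 * Γ * 4 ^ I → 2 ^ Γ * sumW m (λ w → ⟦ exceeds? k c w ⟧ * wt μ w) ≤ prod m (total μ))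
             shape (window-bound k c r) n≤
    drop-yes : ∀ w → ⟦ yes fits ×-dec exceeds? k c w ⟧ ≤ ⟦ exceeds? k c w ⟧
    drop-yes w with exceeds? k c w
    ... | yes _ = ≤-refl
    ... | no  _ = ≤-refl

  violations-bound : 2 ^ Γ * sumW n (λ w → violations n w * wt μ w) ≤ suc n * (suc n * D)
  violations-bound = begin
    2 ^ Γ * sumW n (λ w → violations n w * wt μ w)
      ≡⟨ cong (2 ^ Γ *_) (sumW-cong n λ w _ → distribute w) ⟩
    2 ^ Γ * sumW n (λ w → sumN (suc n) (λ k → sumN (suc n) (λ c → violation n k c w * wt μ w)))
      ≡⟨ cong (2 ^ Γ *_) (sumW-sumN n (suc n) _) ⟩
    2 ^ Γ * sumN (suc n) (λ k → sumW n (λ w → sumN (suc n) (λ c → violation n k c w * wt μ w)))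
      ≡⟨ sym (sumN-*ˡ (suc n) (2 ^ Γ) _) ⟩
    sumN (suc n) (λ k → 2 ^ Γ * sumW n (λ w → sumN (suc n) (λ c → violation n k c w * wt μ w)))
      ≤⟨ sumN-≤ (suc n) (suc n * D) (λ k _ → row k) ⟩
    suc n * (suc n * D) ∎
    where
    open ≤-Reasoning
    distribute : ∀ w → violations n w * wt μ w ≡ sumN (suc n) (λ k → sumN (suc n) (λ c → violation n k c w * wt μ w))
    distribute w = trans (sumN-*ʳ (suc n) (λ k → sumN (suc n) (λ c → violation n k c w)) (wt μ w))
                         (sumN-cong (suc n) λ k → sumN-*ʳ (suc n) (λ c → violation n k c w) (wt μ w))
    row : ∀ k → 2 ^ Γ * sumW n (λ w → sumN (suc n) (λ c → violation n k c w * wt μ w)) ≤ suc n * D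
    row k = begin
      2 ^ Γ * sumW n (λ w → sumN (suc n) (λ c → violation n k c w * wt μ w))
        ≡⟨ cong (2 ^ Γ *_) (sumW-sumN n (suc n) _) ⟩
      2 ^ Γ * sumN (suc n) (λ c → sumW n (λ w → violation n k c w * wt μ w))
        ≡⟨ sym (sumN-*ˡ (suc n) (2 ^ Γ) _) ⟩
      sumN (suc n) (λ c → 2 ^ Γ * sumW n (λ w → violation n k c w * wt μ w))
        ≤⟨ sumN-≤ (suc n) D (λ c _ → violation-bound k c) ⟩
      suc n * D ∎

  -- The `(n + 1)²` pairs of a length and a gap have violations of weight at most `2^-Γ D` each,
  -- hence at most `D / 2` in total.
  D≤2S : D ≤ 2 * S
  D≤2S = *-cancelˡ-≤ (2 ^ Γ) {{m^n≢0 2 Γ}} (+-cancelʳ-≤ (2 ^ Γ * D) _ _ (begin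
    2 ^ Γ * D + 2 ^ Γ * D
      ≡⟨ lem₁ (2 ^ Γ * D) ⟩
    2 * (2 ^ Γ * D)
      ≤⟨ *-monoʳ-≤ 2 (*-monoʳ-≤ (2 ^ Γ) cover) ⟩
    2 * (2 ^ Γ * (S + V))
      ≡⟨ lem₂ (2 ^ Γ) S V ⟩
    2 ^ Γ * (2 * S) + 2 * (2 ^ Γ * V)
      ≤⟨ +-monoʳ-≤ (2 ^ Γ * (2 * S)) (*-monoʳ-≤ 2 violations-bound) ⟩
    2 ^ Γ * (2 * S) + 2 * (suc n * (suc n * D))
      ≡⟨ cong (2 ^ Γ * (2 * S) +_) (lem₃ (suc n) D) ⟩
    2 ^ Γ * (2 * S) + 2 * (suc n * suc n) * D
      ≤⟨ +-monoʳ-≤ (2 ^ Γ * (2 * S)) (*-monoˡ-≤ D union) ⟩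
    2 ^ Γ * (2 * S) + 2 ^ Γ * D ∎))
    where
    open ≤-Reasoning
    V : ℕ
    V = sumW n (λ w → violations n w * wt μ w)
    lem₁ : ∀ x → x + x ≡ 2 * x
    lem₁ = solve-∀
    lem₂ : ∀ g s v → 2 * (g * (s + v)) ≡ g * (2 * s) + 2 * (g * v)
    lem₂ = solve-∀
    lem₃ : ∀ m d → 2 * (m * (m * d)) ≡ 2 * (m * m) * d
    lem₃ = solve-∀
    cover : D ≤ S + V
    cover = begin
      D                         ≡⟨ sym (sumW-wt n μ) ⟩
      sumW n (wt μ)             ≤⟨ sumW-mono n pointwise ⟩
      sumW n (λ w → ⟦ prefixNormal? w ⟧ * wt μ w + violations n w * wt μ w) ≡⟨ sumW-+ n _ _ ⟩
      S + V                     ∎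
      where
      pointwise : ∀ w → length w ≡ n → wt μ w ≤ ⟦ prefixNormal? w ⟧ * wt μ w + violations n w * wt μ w
      pointwise w |w| = begin
        wt μ w           ≡⟨ sym (*-identityˡ (wt μ w)) ⟩
        1 * wt μ w       ≤⟨ *-monoˡ-≤ (wt μ w) (prefixNormal-or-violation n w |w|) ⟩
        (⟦ prefixNormal? w ⟧ + violations n w) * wt μ w ≡⟨ *-distribʳ-+ (wt μ w) ⟦ prefixNormal? w ⟧ _ ⟩
        ⟦ prefixNormal? w ⟧ * wt μ w + violations n w * wt μ w ∎

  X : ℕ → ℕ
  X t = M t * M t

  -- `P n` enters as the squared norm of the indicator. In the squared norm of the weight, each
  -- letter contributes `(M - 1)² + (M + 1)² = 2 (M² + 1)`.
  second-moment : S * S ≤ P n * (2 ^ n * prod n (suc ∘ X))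
  second-moment = begin
    S * S
      ≤⟨ cauchy-schwarz n (λ w → ⟦ prefixNormal? w ⟧) (wt μ) ⟩
    sumW n (λ w → ⟦ prefixNormal? w ⟧ * ⟦ prefixNormal? w ⟧) * sumW n (λ w → wt μ w * wt μ w)
      ≡⟨ cong₂ _*_ (trans (sumW-cong n λ w _ → ⟦⟧-idem (prefixNormal? w)) (sym (P≡sumW n))) squares ⟩
    P n * (2 ^ n * prod n (suc ∘ X)) ∎
    where
    open ≤-Reasoning
    ⟦⟧-idem : ∀ {A : Set} (d : Dec A) → ⟦ d ⟧ * ⟦ d ⟧ ≡ ⟦ d ⟧
    ⟦⟧-idem (yes _) = refl
    ⟦⟧-idem (no  _) = refl
    total² : ∀ t → N t * N t + (2 + N t) * (2 + N t) ≡ 2 * suc (X t)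
    total² t = trans (lem (N t)) (cong (λ m → 2 * suc (m * m)) (sucN t))
      where
      lem : ∀ n → n * n + (2 + n) * (2 + n) ≡ 2 * suc (suc n * suc n)
      lem = solve-∀
    squares : sumW n (λ w → wt μ w * wt μ w) ≡ 2 ^ n * prod n (suc ∘ X)
    squares = trans (sumW-cong n λ w _ → sym (wt-* μ μ w)) (trans (sumW-wt n _)
      (trans (prod-cong n λ t _ → total² t) (trans (prod-* n (λ _ → 2) (suc ∘ X)) (cong (_* prod n (suc ∘ X)) (prod-const n 2)))))

  X≥ : ∀ i t → i < I → K * 4 ^ i ≤ t → 4 ^ suc i ≤ X t
  X≥ i t i<I ≤t = ≤-trans (≤-reflexive ([x*y]^n 2 2 (suc i))) (*-mono-≤ M≥ M≥)
    where
    M≥ : 2 ^ suc i ≤ M t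
    M≥ = ^-monoʳ-≤ 2 (level-≥ I K i i<I ≤t)

  X>0 : ∀ t → 0 < X t
  X>0 t = *-mono-≤ (m^n>0 2 (lev t)) (m^n>0 2 (lev t))

  -- The `3 K 4^i` positions from `K * 4 ^ i` on have `X` at least `4 ^ suc i`, so the product of
  -- their `1 + 1/X` is at most `2 ^ (2 * K)`, independently of `i`.
  entropy-scale : ∀ i → i ≤ I → prod (K * 4 ^ i) (suc ∘ X) ≤ 2 ^ (2 * K * suc i) * prod (K * 4 ^ i) X
  entropy-scale zero    _   = subst (λ e → prod (K * 1) (suc ∘ X) ≤ 2 ^ e * prod (K * 1) X) (sym (*-identityʳ (2 * K)))
    (begin
      prod (K * 1) (suc ∘ X)            ≤⟨ prod-mono (K * 1) (λ t _ → +-monoˡ-≤ (X t) (X>0 t)) ⟩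
      prod (K * 1) (λ t → X t + X t)    ≡⟨ prod-cong (K * 1) (λ t _ → lem (X t)) ⟩
      prod (K * 1) (λ t → 2 * X t)      ≡⟨ trans (prod-* (K * 1) (λ _ → 2) X) (cong (_* prod (K * 1) X) (prod-const (K * 1) 2)) ⟩
      2 ^ (K * 1) * prod (K * 1) X      ≤⟨ *-monoˡ-≤ _ (^-monoʳ-≤ 2 (≤-trans (≤-reflexive (*-identityʳ K)) (m≤m+n K _))) ⟩
      2 ^ (2 * K) * prod (K * 1) X      ∎)
    where
    open ≤-Reasoning
    lem : ∀ x → x + x ≡ 2 * x
    lem = solve-∀
  entropy-scale (suc i) i<I = begin
    prod (K * (4 * 4 ^ i)) (suc ∘ X)
      ≡⟨ cong (λ m → prod m (suc ∘ X)) (lem K (4 ^ i)) ⟩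
    prod (k + 3 * k) (suc ∘ X)
      ≡⟨ prod-+ k (3 * k) (suc ∘ X) ⟩
    prod k (suc ∘ X) * prod (3 * k) (suc ∘ X ∘ (k +_))
      ≤⟨ *-mono-≤ (entropy-scale i (<⇒≤ i<I)) block ⟩
    2 ^ (2 * K * suc i) * prod k X * (2 ^ (2 * K) * prod (3 * k) (X ∘ (k +_)))
      ≡⟨ *-interchange (2 ^ (2 * K * suc i)) _ _ _ ⟩
    2 ^ (2 * K * suc i) * 2 ^ (2 * K) * (prod k X * prod (3 * k) (X ∘ (k +_)))
      ≡⟨ cong₂ _*_ (trans (sym (^-distribˡ-+-* 2 (2 * K * suc i) (2 * K))) (cong (2 ^_) (lem₂ (2 * K) (suc i))))
                   (trans (sym (prod-+ k (3 * k) X)) (cong (λ m → prod m X) (sym (lem K (4 ^ i))))) ⟩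
    2 ^ (2 * K * suc (suc i)) * prod (K * (4 * 4 ^ i)) X ∎
    where
    open ≤-Reasoning
    k : ℕ
    k = K * 4 ^ i
    lem : ∀ K t → K * (4 * t) ≡ K * t + 3 * (K * t)
    lem = solve-∀
    lem₂ : ∀ a b → a * b + a ≡ a * suc b
    lem₂ = solve-∀
    lem₃ : ∀ t → 2 * (2 * t) ≡ 4 * t
    lem₃ = solve-∀
    lem₄ : ∀ K t → 4 * (K * t) ≡ 2 * K * (2 * t)
    lem₄ = solve-∀
    block : prod (3 * k) (suc ∘ X ∘ (k +_)) ≤ 2 ^ (2 * K) * prod (3 * k) (X ∘ (k +_))
    block = prod-suc-block (3 * k) (4 ^ suc i) (2 * K) (X ∘ (k +_)) {{m^n≢0 4 (suc i)}} (2 * 4 ^ i)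
      (λ t → X≥ i (k + t) i<I (m≤m+n k t)) (≤-reflexive (lem₃ (4 ^ i)))
      (≤-trans (*-monoˡ-≤ k (≤ᵇ⇒≤ 3 4 _)) (≤-reflexive (lem₄ K (4 ^ i))))

  entropy : prod n (suc ∘ X) ≤ 2 ^ (2 * K * suc I) * prod n X
  entropy = prod-suc-shorten n (K * 4 ^ I ∸ n) X (2 ^ (2 * K * suc I)) X>0
    (subst (λ m → prod m (suc ∘ X) ≤ 2 ^ (2 * K * suc I) * prod m X) (sym (m+[n∸m]≡n n≤)) (entropy-scale I ≤-refl))

  -- As `D * D` is `4^n` times the product of all `X`, only the ratio bounded by `entropy` is lost,
  -- besides the 4 from squaring `D≤2S`.
  P-lower : 2 ^ n ≤ P n * 2 ^ (2 + 2 * K * suc I)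
  P-lower = *-cancelʳ-≤ _ _ (2 ^ n * prod n X) {{m*n≢0 (2 ^ n) _ {{m^n≢0 2 n}} {{prod≢0 n X>0}}}} (begin
    2 ^ n * (2 ^ n * prod n X)
      ≡⟨ sym D² ⟩
    D * D
      ≤⟨ *-mono-≤ D≤2S D≤2S ⟩
    2 * S * (2 * S)
      ≡⟨ lem₁ S ⟩
    4 * (S * S)
      ≤⟨ *-monoʳ-≤ 4 second-moment ⟩
    4 * (P n * (2 ^ n * prod n (suc ∘ X)))
      ≤⟨ *-monoʳ-≤ 4 (*-monoʳ-≤ (P n) (*-monoʳ-≤ (2 ^ n) entropy)) ⟩
    4 * (P n * (2 ^ n * (2 ^ (2 * K * suc I) * prod n X)))
      ≡⟨ lem₂ (P n) (2 ^ n) (2 ^ (2 * K * suc I)) (prod n X) ⟩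
    P n * (4 * 2 ^ (2 * K * suc I)) * (2 ^ n * prod n X)
      ≡⟨ cong (λ e → P n * e * (2 ^ n * prod n X)) (sym (^-distribˡ-+-* 2 2 (2 * K * suc I))) ⟩
    P n * 2 ^ (2 + 2 * K * suc I) * (2 ^ n * prod n X) ∎)
    where
    open ≤-Reasoning
    lem₁ : ∀ s → 2 * s * (2 * s) ≡ 4 * (s * s)
    lem₁ = solve-∀
    lem₂ : ∀ p a e x → 4 * (p * (a * (e * x))) ≡ p * (4 * e) * (a * x)
    lem₂ = solve-∀
    lem₃ : ∀ a m → a * m * (a * m) ≡ a * (a * (m * m))
    lem₃ = solve-∀
    D² : D * D ≡ 2 ^ n * (2 ^ n * prod n X)
    D² = trans (cong (λ d → d * d) (trans (prod-cong n λ t _ → total-μ t)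
           (trans (prod-* n (λ _ → 2) M) (cong (_* prod n M) (prod-const n 2)))))
         (trans (lem₃ (2 ^ n) (prod n M)) (cong (λ y → 2 ^ n * (2 ^ n * y)) (sym (prod-* n M M))))

P-lower-log : ∀ n → 2 ≤ n → 2 ^ (1 * n) ≤ P n ^ 1 * 2 ^ (2162 * (⌊log₂ n ⌋ * ⌊log₂ n ⌋))
P-lower-log n 2≤n = begin
  2 ^ (1 * n)                              ≡⟨ cong (2 ^_) (*-identityˡ n) ⟩
  2 ^ n                                    ≤⟨ LowerBound.P-lower (suc L) Γ n n≤ union ⟩
  P n * 2 ^ (2 + 2 * (72 * Γ) * (2 + L))   ≤⟨ *-monoʳ-≤ (P n) (^-monoʳ-≤ 2 exponent) ⟩
  P n * 2 ^ (2162 * (L * L))               ≡⟨ cong (_* 2 ^ (2162 * (L * L))) (sym (^-identityʳ (P n))) ⟩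
  P n ^ 1 * 2 ^ (2162 * (L * L))           ∎
  where
  open ≤-Reasoning
  L Γ : ℕ
  L = ⌊log₂ n ⌋
  Γ = 3 + 2 * L
  1≤L : 1 ≤ L
  1≤L = ⌊log₂⌋-mono-≤ 2≤n
  n< : suc n ≤ 2 ^ suc L
  n< = n<2^[1+⌊log₂n⌋] n
  n≤ : n ≤ 72 * Γ * 4 ^ suc L
  n≤ = begin
    n                       ≤⟨ <⇒≤ n< ⟩
    2 ^ suc L               ≤⟨ ^-monoˡ-≤ (suc L) (≤ᵇ⇒≤ 2 4 _) ⟩
    4 ^ suc L               ≤⟨ m≤n*m (4 ^ suc L) (72 * Γ) ⟩
    72 * Γ * 4 ^ suc L      ∎
  union : 2 * (suc n * suc n) ≤ 2 ^ Γ
  union = begin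
    2 * (suc n * suc n)             ≤⟨ *-monoʳ-≤ 2 (*-mono-≤ n< n<) ⟩
    2 * (2 ^ suc L * 2 ^ suc L)     ≡⟨ cong (2 *_) (sym (^-distribˡ-+-* 2 (suc L) (suc L))) ⟩
    2 ^ (1 + (suc L + suc L))       ≡⟨ cong (2 ^_) (lem L) ⟩
    2 ^ Γ                           ∎
    where
    lem : ∀ L → 1 + (suc L + suc L) ≡ 3 + 2 * L
    lem = solve-∀
  -- Constants are bounded by multiples of `L`, which is at least 1: `2162 = 2 + 2 · 72 · 5 · 3`.
  exponent : 2 + 2 * (72 * Γ) * (2 + L) ≤ 2162 * (L * L)
  exponent = begin
    2 + 2 * (72 * (3 + 2 * L)) * (2 + L)
      ≤⟨ +-mono-≤ (*-monoʳ-≤ 2 (*-mono-≤ 1≤L 1≤L)) (*-mono-≤ (*-monoʳ-≤ 2 (*-monoʳ-≤ 72 (+-monoˡ-≤ (2 * L) (*-monoʳ-≤ 3 1≤L))))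
                               (+-monoˡ-≤ L (*-monoʳ-≤ 2 1≤L))) ⟩
    2 * (L * L) + 2 * (72 * (3 * L + 2 * L)) * (2 * L + L)
      ≡⟨ lem L ⟩
    2162 * (L * L) ∎
    where
    lem : ∀ L → 2 * (L * L) + 2 * (72 * (3 * L + 2 * L)) * (2 * L + L) ≡ 2162 * (L * L)
    lem = solve-∀

-- Both bounds in terms of the binary logarithm.

-- Rounding the logarithm down to `b * h` loses less than `b`, so at most a factor 2 once `h` is
-- positive; `2 ≤ h` also supplies the condition on `h * h` in `P-upper-square`.
log-multiple : ∀ b .{{_ : NonZero b}} n → 2 ^ (2 * b) ≤ n →
               Σ ℕ λ h → 2 ≤ h × ⌊log₂ n ⌋ ≤ 2 * b * h × 2 ^ (b * h) ≤ n
log-multiple b n N≤n = h , 2≤h , L≤ , big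
  where
  open ≤-Reasoning
  L h : ℕ
  L = ⌊log₂ n ⌋
  h = L / b
  2≤h : 2 ≤ h
  2≤h = subst (_≤ h) (m*n/n≡m 2 b) (/-mono-≤ {o = b}
          (subst (_≤ L) (⌊log₂[2^n]⌋≡n (2 * b)) (⌊log₂⌋-mono-≤ N≤n)) ≤-refl)
  L≤ : L ≤ 2 * b * h
  L≤ = begin
    L                          ≡⟨ m≡m%n+[m/n]*n L b ⟩
    L % b + h * b              ≤⟨ +-monoˡ-≤ (h * b) (<⇒≤ (m%n<n L b)) ⟩
    b + h * b                  ≤⟨ +-monoˡ-≤ (h * b) (m≤n*m b h {{>-nonZero (<⇒≤ 2≤h)}}) ⟩
    h * b + h * b              ≡⟨ lem h b ⟩
    2 * b * h                  ∎
    where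
    lem : ∀ h b → h * b + h * b ≡ 2 * b * h
    lem = solve-∀
  big : 2 ^ (b * h) ≤ n
  big = begin
    2 ^ (b * h)                ≤⟨ ^-monoʳ-≤ 2 (≤-trans (≤-reflexive (*-comm b h)) (m/n*n≤m L b)) ⟩
    2 ^ L                      ≤⟨ 2^⌊log₂n⌋≤n n {{>-nonZero (≤-trans (m^n>0 2 (2 * b)) N≤n)}} ⟩
    n                          ∎

P-lower : Σ ℕ λ p → 0 < p × (∀ n → 2 ≤ n → 2 ^ (1 * n) ≤ P n ^ 1 * 2 ^ (p * (⌊log₂ n ⌋ * ⌊log₂ n ⌋)))
P-lower = 2162 , s≤s z≤n , P-lower-log

upper-eventually : Σ ℕ λ q → Σ ℕ λ N → 0 < q × (∀ n → N ≤ n →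
  P n ^ q * 2 ^ (1 * (⌊log₂ n ⌋ * ⌊log₂ n ⌋)) ≤ 2 ^ (q * n))
upper-eventually = case P-upper of λ (b , b>0 , upper) →
  let b≢0 = >-nonZero b>0
      c>0 = ≤-trans b>0 (m≤m+n b _)
  in 2 * (2 * b * (2 * b)) , 2 ^ (2 * b) , *-mono-≤ {1} {2} (s≤s z≤n) (*-mono-≤ c>0 c>0) , λ n N≤n →
  let h , 2≤h , L≤ch , big = log-multiple b {{b≢0}} n N≤n
      h≢0 = >-nonZero (<⇒≤ 2≤h)
  in P-upper-square (2 * b) h n (≤-trans 2≤h (m≤m*n h h {{h≢0}})) L≤ch (upper h {{h≢0}} n big)

-- The constants are the rationals `c₁ = p₁ / q₁` and `c₂ = p₂ / q₂`, and the powers `q₁` and `q₂`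
-- clear their denominators. Replacing the logarithm by `⌊log₂ n ⌋` changes only the constants.
theorem1 : Σ ℕ λ p₁ → Σ ℕ λ q₁ → Σ ℕ λ p₂ → Σ ℕ λ q₂ → Σ ℕ λ N →
    (0 < p₁) × (0 < q₁) × (0 < p₂) × (0 < q₂) × (p₁ * q₂ ≤ p₂ * q₁) ×
    (∀ n → N ≤ n →
    (2 ^ (q₂ * n) ≤ P n ^ q₂ * 2 ^ (p₂ * (⌊log₂ n ⌋ * ⌊log₂ n ⌋)))
    × (P n ^ q₁ * 2 ^ (p₁ * (⌊log₂ n ⌋ * ⌊log₂ n ⌋)) ≤ 2 ^ (q₁ * n)))
theorem1 = case upper-eventually of λ (q₁ , N , q₁>0 , upper) → case P-lower of λ (p₂ , p₂>0 , lower) →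
  1 , q₁ , p₂ , 1 , N + 2 , s≤s z≤n , q₁>0 , p₂>0 , s≤s z≤n , *-mono-≤ p₂>0 q₁>0 ,
  λ n N+2≤n → lower n (≤-trans (m≤n+m 2 N) N+2≤n) , upper n (≤-trans (m≤m+n N 2) N+2≤n)
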